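{- Let $M \models \mathbf{PA}^-$ and $n \geq 0$. The following are equivalent: 1. $M \models \mathbf{Coll}_{\mathrm{w}}^{\mathrm{d}}(\Sigma_{n+1})$. 2. $M \models \mathbf{Coll}_{\mathrm{w}}^-(\Sigma_{n+1})$. 3. $M$ satisfies the conditions $\mathsf{end}_{n}$ and $\mathsf{COF}_{n+2}^{\equiv}$. 4. $M$ satisfies the conditions $\mathsf{end}_{n}$ and $\mathsf{cof}_{n+2}^{\equiv}$.
   Context: $\mathcal{L}_A=\{0,1,+,\times,<\}$ is the language of first-order arithmetic, and $\mathbf{PA}^-$ is the $\mathcal{L}_A$-theory of the non-negative parts of commutative discretely ordered rings. $\Delta_0=\Sigma_0=\Pi_0$ is the class of $\mathcal{L}_A$-formulas all of whose quantifiers are bounded; $\Sigma_{n+1}$ (resp. $\Pi_{n+1}$) formulas are those of the form $\exists \vec{y}\,\varphi$ with $\varphi\in\Pi_n$ (resp. $\forall \vec{y}\,\varphi$ with $\varphi\in\Sigma_n$), where $\vec{y}$ is a finite, possibly empty, tuple. Vector notation denotes finite (possibly empty) tuples of variables or elements; for tuples of the same length, $\vec{x}<\vec{u}$ means $x_i<u_i$ for every $i$. $M\subseteq N$ means $M$ is a substructure of $N$; $M\prec N$ means $N$ is an elementary extension of $M$; $M\prec_\Gamma N$ means $M\subseteq N$ and for every $\vec{a}\in M$ and every $\varphi(\vec{x})\in\Gamma$, $M\models\varphi(\vec{a})$ iff $N\models\varphi(\vec{a})$; $M\equiv_{\Sigma_k}K$ means $M$ and $K$ satisfy the same $\Sigma_k$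 sentences. $K$ is a cofinal extension of $M$ iff $M\subseteq K$ and for every $a\in K$ there is $b\in M$ with $K\models a<b$. For $M,N\models\mathbf{PA}^-$ with $M\subseteq N$, $\sup_N(M):=\{a\in N\mid \exists b\in M\ (N\models a\leq b)\}$, regarded as a substructure of $N$ (it is again a model of $\mathbf{PA}^-$). $\mathbf{Coll}_{\mathrm{w}}^{\mathrm{d}}(\Gamma)$ is the scheme $\forall \vec{z}\,\forall \vec{x}\,\exists \vec{y}\,\varphi(\vec{x},\vec{y},\vec{z})\to\forall \vec{z}\,\forall \vec{u}\,\exists \vec{v}\,\forall \vec{x}<\vec{u}\,\exists \vec{y}<\vec{v}\,\varphi(\vec{x},\vec{y},\vec{z})$ for $\varphi\in\Gamma$. $\mathbf{Coll}_{\mathrm{w}}^-(\Gamma)$ is the scheme $\forall \vec{x}\,\exists \vec{y}\,\varphi(\vec{x},\vec{y})\to\forall \vec{u}\,\exists \vec{v}\,\forall \vec{x}<\vec{u}\,\exists \vec{y}<\vec{v}\,\varphi(\vec{x},\vec{y})$ for $\varphi\in\Gamma$ (with no free variables other than $\vec{x},\vec{y}$). For $M\models\mathbf{PA}^-$ and $k\geq 0$: $M$ satisfies $\mathsf{end}_k$ iff for every $N\models\mathbf{PA}^-$ with $M\prec N$, $\sup_N(M)\prec_{\Sigma_k}N$; $M$ satisfies $\mathsf{cof}_k^{\equiv}$ iff for every $N\models\mathbf{PA}^-$ with $M\prec N$, $M\equiv_{\Sigma_k}\sup_N(M)$; $M$ satisfies $\mathsf{COF}_k^{\equiv}$ iff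 for every $K\models\mathbf{PA}^-$ such that $M\prec_{\Delta_0}K$ and $K$ is a cofinal extension of $M$, $M\equiv_{\Sigma_k}K$. -}

module Defs where

open import Algebra.Bundles.Raw using (RawSemiring)
open import Algebra.Core using (Op₂)
open import Algebra.Morphism.Structures using (IsSemiringMonomorphism; module SemiringMorphisms)
open import Algebra.Structures using (IsCommutativeSemiring)
open import Data.Fin.Base using (Fin; zero; suc)
open import Data.Nat.Base using (ℕ; zero; suc) renaming (_+_ to _+ⁿ_)
open import Data.Product.Base using (Σ; ∃; _×_; _,_; proj₁; proj₂)
open import Data.Sum.Base using (_⊎_; inj₁; inj₂)
open import Data.Unit.Base using (⊤)
open import Data.Vec.Base using (Vec; []; _∷_; _++_; lookup; map)
open import Data.Vec.Relation.Binary.Pointwise.Inductive using (Pointwise)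
open import Function.Base using (_on_; id)
open import Function.Bundles using (_⇔_; mk⇔)
open import Level using (Level) renaming (suc to lsuc)
open import Relation.Binary.Core using (Rel)
open import Relation.Binary.Definitions using (_Respects₂_)
open import Relation.Binary.Structures using (IsEquivalence; IsStrictTotalOrder)
open import Relation.Nullary.Negation.Core using (¬_)

------------------------------------------------------------------------
-- Syntax of first-order arithmetic

-- Terms and formulas are well-scoped: indices are de Bruijn, and the index
-- n bounds the free variables.

infixl 7 _*'_
infixl 6 _+'_
infix  5 _≈'_ _<'_
infixr 4 _∧'_
infixr 3 _∨'_
infixr 2 _⇒'_

data Term (n : ℕ) : Set where
  var       : Fin n → Term n
  0' 1'     : Term n
  _+'_ _*'_ : Term n → Term n → Term n

data Formula (n : ℕ) : Set where
  _≈'_ _<'_      : Term n → Term n → Formula n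
  ¬'_            : Formula n → Formula n
  _∧'_ _∨'_ _⇒'_ : Formula n → Formula n → Formula n
  ∀'_ ∃'_        : Formula (suc n) → Formula n

weaken : ∀ {n} → Term n → Term (suc n)
weaken (var i)  = var (suc i)
weaken 0'       = 0'
weaken 1'       = 1'
weaken (s +' t) = weaken s +' weaken t
weaken (s *' t) = weaken s *' weaken t

FormulaClass : Set₁
FormulaClass = ∀ {n} → Formula n → Set

-- In the bounded quantifiers ∀x<t and ∃x<t the variable x does not occur
-- in the bound, which is therefore a weakened term.
data IsΔ₀ {n : ℕ} : Formula n → Set where
  eq  : ∀ s t → IsΔ₀ (s ≈' t)
  lt  : ∀ s t → IsΔ₀ (s <' t)
  neg : ∀ {φ} → IsΔ₀ φ → IsΔ₀ (¬' φ)
  and : ∀ {φ ψ} → IsΔ₀ φ → IsΔ₀ ψ → IsΔ₀ (φ ∧' ψ)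
  or  : ∀ {φ ψ} → IsΔ₀ φ → IsΔ₀ ψ → IsΔ₀ (φ ∨' ψ)
  imp : ∀ {φ ψ} → IsΔ₀ φ → IsΔ₀ ψ → IsΔ₀ (φ ⇒' ψ)
  all< : ∀ t {φ} → IsΔ₀ φ → IsΔ₀ (∀' (var zero <' weaken t ⇒' φ))
  ex<  : ∀ t {φ} → IsΔ₀ φ → IsΔ₀ (∃' (var zero <' weaken t ∧' φ))

-- A Σₖ₊₁ formula is a finite, possibly empty, block of ∃ in front of a Πₖ
-- formula: `matrix` is the empty block and `ex` prolongs the block by one.
-- Dually for Πₖ₊₁.
mutual
  data IsΣ : ℕ → ∀ {n} → Formula n → Set where
    Δ₀     : ∀ {n} {φ : Formula n} → IsΔ₀ φ → IsΣ 0 φ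
    matrix : ∀ {k n} {φ : Formula n} → IsΠ k φ → IsΣ (suc k) φ
    ex     : ∀ {k n} {φ : Formula (suc n)} → IsΣ (suc k) φ → IsΣ (suc k) (∃' φ)

  data IsΠ : ℕ → ∀ {n} → Formula n → Set where
    Δ₀     : ∀ {n} {φ : Formula n} → IsΔ₀ φ → IsΠ 0 φ
    matrix : ∀ {k n} {φ : Formula n} → IsΣ k φ → IsΠ (suc k) φ
    all    : ∀ {k n} {φ : Formula (suc n)} → IsΠ (suc k) φ → IsΠ (suc k) (∀' φ)

------------------------------------------------------------------------
-- Structures and satisfaction

-- Equality is interpreted by the setoid equality of the carrier.
record Structure (ℓ : Level) : Set (lsuc ℓ) where
  infixl 7 _*_
  infixl 6 _+_
  infix  4 _≈_ _<_ _≤_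
  field
    Carrier       : Set ℓ
    _≈_           : Rel Carrier ℓ
    _<_           : Rel Carrier ℓ
    _+_ _*_       : Op₂ Carrier
    0# 1#         : Carrier
    isEquivalence : IsEquivalence _≈_
    +-cong        : ∀ {x x' y y'} → x ≈ x' → y ≈ y' → x + y ≈ x' + y'
    *-cong        : ∀ {x x' y y'} → x ≈ x' → y ≈ y' → x * y ≈ x' * y'
    <-resp-≈      : _<_ Respects₂ _≈_

  _≤_ : Rel Carrier ℓ
  x ≤ y = x < y ⊎ x ≈ y

  rawSemiring : RawSemiring ℓ ℓ
  rawSemiring = record
    { Carrier = Carrier ; _≈_ = _≈_ ; _+_ = _+_ ; _*_ = _*_ ; 0# = 0# ; 1# = 1# }

∣_∣ : ∀ {ℓ} → Structure ℓ → Set ℓ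
∣ M ∣ = Structure.Carrier M

module _ {ℓ : Level} (M : Structure ℓ) where
  open Structure M

  ⟦_⟧ : ∀ {n} → Term n → Vec Carrier n → Carrier
  ⟦ var i ⟧  ρ = lookup ρ i
  ⟦ 0' ⟧     ρ = 0#
  ⟦ 1' ⟧     ρ = 1#
  ⟦ s +' t ⟧ ρ = ⟦ s ⟧ ρ + ⟦ t ⟧ ρ
  ⟦ s *' t ⟧ ρ = ⟦ s ⟧ ρ * ⟦ t ⟧ ρ

  infix 1 _⊨_[_]
  _⊨_[_] : ∀ {n} → Formula n → Vec Carrier n → Set ℓ
  _⊨_[_] (s ≈' t) ρ = ⟦ s ⟧ ρ ≈ ⟦ t ⟧ ρ
  _⊨_[_] (s <' t) ρ = ⟦ s ⟧ ρ < ⟦ t ⟧ ρ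
  _⊨_[_] (¬' φ)   ρ = ¬ (_⊨_[_] φ ρ)
  _⊨_[_] (φ ∧' ψ) ρ = _⊨_[_] φ ρ × _⊨_[_] ψ ρ
  _⊨_[_] (φ ∨' ψ) ρ = _⊨_[_] φ ρ ⊎ _⊨_[_] ψ ρ
  _⊨_[_] (φ ⇒' ψ) ρ = _⊨_[_] φ ρ → _⊨_[_] ψ ρ
  _⊨_[_] (∀' φ)   ρ = ∀ x → _⊨_[_] φ (x ∷ ρ)
  _⊨_[_] (∃' φ)   ρ = ∃ λ x → _⊨_[_] φ (x ∷ ρ)

  -- Trichotomy is part of IsStrictTotalOrder; the remaining fields are the
  -- usual ordering axioms of the non-negative part of a discretely ordered ring.
  record PA⁻ : Set ℓ where
    field
      isCommutativeSemiring : IsCommutativeSemiring _≈_ _+_ _*_ 0# 1#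
      isStrictTotalOrder    : IsStrictTotalOrder _≈_ _<_
      +-monoˡ-<             : ∀ {x y} z → x < y → x + z < y + z
      *-monoˡ-<             : ∀ {x y} z → 0# < z → x < y → x * z < y * z
      subtraction           : ∀ {x y} → x < y → ∃ λ z → x + z ≈ y
      0<1                   : 0# < 1#
      discrete              : ∀ {x} → 0# < x → 1# ≤ x
      0≤                    : ∀ x → 0# ≤ x

  infix 4 _<ᵛ_
  _<ᵛ_ : ∀ {n} → Vec Carrier n → Vec Carrier n → Set ℓ
  _<ᵛ_ = Pointwise _<_

  -- The variables of φ are split into the tuples y⃗, x⃗, z⃗, of lengths q, p, r.
  Coll-w-d : FormulaClass → Set ℓ
  Coll-w-d Γ = ∀ {p q r} (φ : Formula (q +ⁿ (p +ⁿ r))) → Γ φ →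
    (∀ (zs : Vec Carrier r) (xs : Vec Carrier p) →
       ∃ λ (ys : Vec Carrier q) → _⊨_[_] φ (ys ++ (xs ++ zs))) →
    (∀ (zs : Vec Carrier r) (us : Vec Carrier p) →
       ∃ λ (vs : Vec Carrier q) → ∀ (xs : Vec Carrier p) → xs <ᵛ us →
       ∃ λ (ys : Vec Carrier q) → ys <ᵛ vs × _⊨_[_] φ (ys ++ (xs ++ zs)))

  Coll-w-minus : FormulaClass → Set ℓ
  Coll-w-minus Γ = ∀ {p q} (φ : Formula (q +ⁿ p)) → Γ φ →
    (∀ (xs : Vec Carrier p) →
       ∃ λ (ys : Vec Carrier q) → _⊨_[_] φ (ys ++ xs)) →
    (∀ (us : Vec Carrier p) →
       ∃ λ (vs : Vec Carrier q) → ∀ (xs : Vec Carrier p) → xs <ᵛ us →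
       ∃ λ (ys : Vec Carrier q) → ys <ᵛ vs × _⊨_[_] φ (ys ++ xs))

------------------------------------------------------------------------
-- Extensions

-- M is identified with its image in N, so M ⊆ N is an embedding.
infix 4 _⊆_
record _⊆_ {ℓ} (M N : Structure ℓ) : Set ℓ where
  private
    module M = Structure M
    module N = Structure N
  field
    ι                      : M.Carrier → N.Carrier
    isSemiringMonomorphism : SemiringMorphisms.IsSemiringMonomorphism M.rawSemiring N.rawSemiring ι
    <-⇔                    : ∀ x y → x M.< y ⇔ ι x N.< ι y

module _ {ℓ : Level} {M N : Structure ℓ} where

  Elementary[_] : FormulaClass → M ⊆ N → Set ℓ
  Elementary[ Γ ] e = ∀ {n} (φ : Formula n) → Γ φ → (as : Vec ∣ M ∣ n) →
    (M ⊨ φ [ as ]) ⇔ (N ⊨ φ [ map (_⊆_.ι e) as ])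

  Elementary : M ⊆ N → Set ℓ
  Elementary = Elementary[ (λ _ → ⊤) ]

  Cofinal : M ⊆ N → Set ℓ
  Cofinal e = ∀ (a : ∣ N ∣) → ∃ λ (b : ∣ M ∣) → Structure._<_ N a (_⊆_.ι e b)

infix 4 _≡Σ[_]_
_≡Σ[_]_ : ∀ {ℓ} → Structure ℓ → ℕ → Structure ℓ → Set ℓ
M ≡Σ[ k ] K = ∀ (φ : Formula 0) → IsΣ k φ → (M ⊨ φ [ [] ]) ⇔ (K ⊨ φ [ [] ])

module _ {ℓ : Level} {N : Structure ℓ} (pa : PA⁻ N) where
  open Structure N
  open PA⁻ pa
  open IsCommutativeSemiring isCommutativeSemiring
    using (refl; sym; trans; +-comm; *-comm; zeroʳ)
  open IsStrictTotalOrder isStrictTotalOrder using () renaming (trans to <-trans)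

  ≤-trans : ∀ {x y z} → x ≤ y → y ≤ z → x ≤ z
  ≤-trans (inj₁ p) (inj₁ q) = inj₁ (<-trans p q)
  ≤-trans (inj₁ p) (inj₂ q) = inj₁ (proj₁ <-resp-≈ q p)
  ≤-trans (inj₂ p) (inj₁ q) = inj₁ (proj₂ <-resp-≈ (sym p) q)
  ≤-trans (inj₂ p) (inj₂ q) = inj₂ (trans p q)

  +-monoˡ-≤ : ∀ {x y} z → x ≤ y → x + z ≤ y + z
  +-monoˡ-≤ z (inj₁ p) = inj₁ (+-monoˡ-< z p)
  +-monoˡ-≤ z (inj₂ p) = inj₂ (+-cong p refl)

  *-monoˡ-≤ : ∀ {x y} z → x ≤ y → x * z ≤ y * z
  *-monoˡ-≤ z (inj₂ p) = inj₂ (*-cong p refl)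
  *-monoˡ-≤ {x} {y} z (inj₁ p) with 0≤ z
  ... | inj₁ 0<z = inj₁ (*-monoˡ-< z 0<z p)
  ... | inj₂ 0≈z = inj₂ (trans (trans (*-cong refl (sym 0≈z)) (zeroʳ x))
                        (sym (trans (*-cong refl (sym 0≈z)) (zeroʳ y))))

  +-mono-≤ : ∀ {x x' y y'} → x ≤ x' → y ≤ y' → x + y ≤ x' + y'
  +-mono-≤ {x' = x'} {y} {y'} p q = ≤-trans (+-monoˡ-≤ y p)
    (≤-trans (inj₂ (+-comm x' y)) (≤-trans (+-monoˡ-≤ x' q) (inj₂ (+-comm y' x'))))

  *-mono-≤ : ∀ {x x' y y'} → x ≤ x' → y ≤ y' → x * y ≤ x' * y'
  *-mono-≤ {x' = x'} {y} {y'} p q = ≤-trans (*-monoˡ-≤ y p)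
    (≤-trans (inj₂ (*-comm x' y)) (≤-trans (*-monoˡ-≤ x' q) (inj₂ (*-comm y' x'))))

-- The axioms PA⁻ of N are what makes {a ∈ N ∣ ∃ b ∈ M, a ≤ b} closed under
-- the operations.  Elements carry a bound, which equality ignores.
module _ {ℓ : Level} {M N : Structure ℓ} (pa : PA⁻ N) (e : M ⊆ N) where
  private
    module M = Structure M
    module N = Structure N
  open _⊆_ e
  open IsSemiringMonomorphism isSemiringMonomorphism using (+-homo; *-homo; 0#-homo; 1#-homo)
  open IsEquivalence N.isEquivalence using (refl; sym; trans)

  sup : Structure ℓ
  sup = record
    { Carrier = Σ N.Carrier λ a → ∃ λ (b : M.Carrier) → a N.≤ ι b
    ; _≈_ = N._≈_ on proj₁
    ; _<_ = N._<_ on proj₁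
    ; _+_ = λ (a , b , a≤b) (a' , b' , a'≤b') → a N.+ a' , b M.+ b' ,
        ≤-trans pa (+-mono-≤ pa a≤b a'≤b') (inj₂ (sym (+-homo b b')))
    ; _*_ = λ (a , b , a≤b) (a' , b' , a'≤b') → a N.* a' , b M.* b' ,
        ≤-trans pa (*-mono-≤ pa a≤b a'≤b') (inj₂ (sym (*-homo b b')))
    ; 0# = N.0# , M.0# , inj₂ (sym 0#-homo)
    ; 1# = N.1# , M.1# , inj₂ (sym 1#-homo)
    ; isEquivalence = record { refl = refl ; sym = sym ; trans = trans }
    ; +-cong = N.+-cong
    ; *-cong = N.*-cong
    ; <-resp-≈ = proj₁ N.<-resp-≈ , proj₂ N.<-resp-≈
    }

  sup⊆ : sup ⊆ N
  sup⊆ = record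
    { ι = proj₁
    ; isSemiringMonomorphism = record
      { isSemiringHomomorphism = record
        { isNearSemiringHomomorphism = record
          { +-isMonoidHomomorphism = record
            { isMagmaHomomorphism = record
              { isRelHomomorphism = record { cong = id }
              ; homo = λ _ _ → refl
              }
            ; ε-homo = refl
            }
          ; *-homo = λ _ _ → refl
          }
        ; 1#-homo = refl
        }
      ; injective = id
      }
    ; <-⇔ = λ _ _ → mk⇔ id id
    }

------------------------------------------------------------------------
-- Conditions on extensions

module _ {ℓ : Level} (M : Structure ℓ) (k : ℕ) where

  end : Set (lsuc ℓ)
  end = ∀ (N : Structure ℓ) (pa : PA⁻ N) (e : M ⊆ N) → Elementary e →
    Elementary[ IsΣ k ] (sup⊆ pa e)

  cof≡ : Set (lsuc ℓ)
  cof≡ = ∀ (N : Structure ℓ) (pa : PA⁻ N) (e : M ⊆ N) → Elementary e →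
    M ≡Σ[ k ] sup pa e

  COF≡ : Set (lsuc ℓ)
  COF≡ = ∀ (K : Structure ℓ) → PA⁻ K → (e : M ⊆ K) → Elementary[ IsΔ₀ ] e →
    Cofinal e → M ≡Σ[ k ] K

{-# OPTIONS --safe #-}
module Submission where

open import Defs
open import Algebra.Morphism.Structures using (module SemiringMorphisms)
open import Algebra.Structures using (IsCommutativeSemiring)
open import Algebra.Structures.Biased using (isCommutativeMonoidˡ; isCommutativeSemiringˡ)
open import Axiom.ExcludedMiddle using (ExcludedMiddle)
open import Axiom.Extensionality.Propositional using (Extensionality)
open import Data.Bool.Base using (Bool; true; false; T)
open import Data.Empty using (⊥-elim)
open import Data.Fin.Base as Fin using (Fin; zero; suc; _↑ˡ_; _↑ʳ_)
open import Data.Nat.Base using (ℕ; zero; suc) renaming (_+_ to _+ⁿ_)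
open import Data.Product.Base using (∃; _×_; _,_; proj₁; proj₂)
open import Data.Product.Function.NonDependent.Propositional using (_×-⇔_)
open import Data.Sum.Base using (_⊎_; inj₁; inj₂; [_,_]′; swap)
open import Data.Sum.Function.Propositional using (_⊎-⇔_)
open import Data.Unit.Base using (⊤)
open import Data.Vec.Base as Vec using (Vec; []; _∷_; _++_; lookup; map; replicate; splitAt; tabulate)
open import Data.Vec.Properties
  using (lookup-++ˡ; lookup-++ʳ; lookup-map; map-++; map-∘; tabulate-∘; tabulate∘lookup)
import Data.Vec.Relation.Binary.Pointwise.Inductive as Pointwise
open Pointwise using (Pointwise; []; _∷_)
open import Function.Base using (id; case_of_)
open import Function.Bundles using (_⇔_; mk⇔; module Equivalence)
open import Function.Construct.Composition using (_⇔-∘_)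
open import Function.Construct.Identity using (⇔-id)
open import Function.Construct.Symmetry using (⇔-sym)
open import Function.Related.TypeIsomorphisms using (→-cong-⇔; ¬-cong-⇔)
open import Level using (Level; Lift; lift; _⊔_) renaming (suc to lsuc)
open import Relation.Binary.Definitions using (Trichotomous; tri<; tri≈; tri>)
open import Relation.Binary.PropositionalEquality
  using (_≡_; refl; sym; trans; cong; cong₂; subst)
open import Relation.Binary.Structures using (IsEquivalence; IsStrictTotalOrder)
open import Relation.Nullary using (¬_; Dec; yes; no)
open import Relation.Nullary.Decidable using (isYes; toWitness; fromWitness)

-- Coll ⇒ end, COF.  Over a cofinal Δ₀-elementary K ⊇ M, weak collection for Σₙ₊₁ makes every
-- Σₙ formula, restricted to arguments below some u ∈ M, equivalent to one and the same
-- Δ₀ formula with parameters from M, both in M and in K: each unbounded quantifier may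
-- be bounded in M, and that the bound also suffices in K is again a Δ₀ fact about M.
-- Hence Σₙ₊₂ sentences transfer between M and K.  For K = sup_N(M) the equivalence with
-- the Δ₀ formula also holds in N, by M ≺ N, which gives sup_N(M) ≺_Σₙ N.
--
-- end, cof ⇒ Coll.  Let N be an ultrapower of M along an ultrafilter on M containing the
-- final segments, so that the identity represents an element d above M.  If collection for
-- φ failed below u, counterexamples for all bounds i ∈ M would form a tuple x < u of N
-- without witness below d.  But x lies in sup_N(M), which satisfies ∀x ∃y φ by cof,
-- and the witness there is below d and remains one in N by end.
--
-- Excluded middle decides arbitrary types, so it also provides choice.

open Equivalence using (to; from)

private variable
  a ℓ : Level
  A : Set a
  k m n p q r : ℕ

-- Propositional equivalences.

∀-⇔ : {P Q : A → Set ℓ} → (∀ x → P x ⇔ Q x) → (∀ x → P x) ⇔ (∀ x → Q x)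
∀-⇔ h = mk⇔ (λ f x → to (h x) (f x)) (λ f x → from (h x) (f x))

∃-⇔ : {P Q : A → Set ℓ} → (∀ x → P x ⇔ Q x) → ∃ P ⇔ ∃ Q
∃-⇔ h = mk⇔ (λ (x , p) → x , to (h x) p) (λ (x , q) → x , from (h x) q)

≡⇒⇔ : {P Q : Set ℓ} → P ≡ Q → P ⇔ Q
≡⇒⇔ refl = ⇔-id _

-- Renaming of variables

renᵗ : (Fin m → Fin n) → Term m → Term n
renᵗ ρ (var i)  = var (ρ i)
renᵗ ρ 0'       = 0'
renᵗ ρ 1'       = 1'
renᵗ ρ (s +' t) = renᵗ ρ s +' renᵗ ρ t
renᵗ ρ (s *' t) = renᵗ ρ s *' renᵗ ρ t

ren : (Fin m → Fin n) → Formula m → Formula n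
ren ρ (s ≈' t) = renᵗ ρ s ≈' renᵗ ρ t
ren ρ (s <' t) = renᵗ ρ s <' renᵗ ρ t
ren ρ (¬' φ)   = ¬' ren ρ φ
ren ρ (φ ∧' ψ) = ren ρ φ ∧' ren ρ ψ
ren ρ (φ ∨' ψ) = ren ρ φ ∨' ren ρ ψ
ren ρ (φ ⇒' ψ) = ren ρ φ ⇒' ren ρ ψ
ren ρ (∀' φ)   = ∀' ren (Fin.lift 1 ρ) φ
ren ρ (∃' φ)   = ∃' ren (Fin.lift 1 ρ) φ

-- `all<` and `ex<` demand a bound of the form `weaken t`; this restores that form after renaming
-- under a binder.
renᵗ-weaken : (ρ : Fin m → Fin n) (t : Term m) →
  renᵗ (Fin.lift 1 ρ) (weaken t) ≡ weaken (renᵗ ρ t)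
renᵗ-weaken ρ (var i)  = refl
renᵗ-weaken ρ 0'       = refl
renᵗ-weaken ρ 1'       = refl
renᵗ-weaken ρ (s +' t) = cong₂ _+'_ (renᵗ-weaken ρ s) (renᵗ-weaken ρ t)
renᵗ-weaken ρ (s *' t) = cong₂ _*'_ (renᵗ-weaken ρ s) (renᵗ-weaken ρ t)

ren-Δ₀ : (ρ : Fin m → Fin n) {φ : Formula m} → IsΔ₀ φ → IsΔ₀ (ren ρ φ)
ren-Δ₀ ρ (eq s t)  = eq _ _
ren-Δ₀ ρ (lt s t)  = lt _ _
ren-Δ₀ ρ (neg d)   = neg (ren-Δ₀ ρ d)
ren-Δ₀ ρ (and d e) = and (ren-Δ₀ ρ d) (ren-Δ₀ ρ e)
ren-Δ₀ ρ (or d e)  = or (ren-Δ₀ ρ d) (ren-Δ₀ ρ e)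
ren-Δ₀ ρ (imp d e) = imp (ren-Δ₀ ρ d) (ren-Δ₀ ρ e)
ren-Δ₀ ρ (all< t d) rewrite renᵗ-weaken ρ t = all< _ (ren-Δ₀ _ d)
ren-Δ₀ ρ (ex< t d)  rewrite renᵗ-weaken ρ t = ex< _ (ren-Δ₀ _ d)

ren-Σ : (ρ : Fin m → Fin n) {φ : Formula m} → IsΣ k φ → IsΣ k (ren ρ φ)
ren-Π : (ρ : Fin m → Fin n) {φ : Formula m} → IsΠ k φ → IsΠ k (ren ρ φ)
ren-Σ ρ (Δ₀ d)     = Δ₀ (ren-Δ₀ ρ d)
ren-Σ ρ (matrix d) = matrix (ren-Π ρ d)
ren-Σ ρ (ex d)     = ex (ren-Σ _ d)
ren-Π ρ (Δ₀ d)     = Δ₀ (ren-Δ₀ ρ d)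
ren-Π ρ (matrix d) = matrix (ren-Σ ρ d)
ren-Π ρ (all d)    = all (ren-Π _ d)

Renames : (Fin m → Fin n) → Vec A m → Vec A n → Set _
Renames ρ xs ys = ∀ i → lookup ys (ρ i) ≡ lookup xs i

lift-renames : {ρ : Fin m → Fin n} {xs : Vec A m} {ys : Vec A n} (zs : Vec A q) →
  Renames ρ xs ys → Renames (Fin.lift q ρ) (zs ++ xs) (zs ++ ys)
lift-renames []       h i       = h i
lift-renames (z ∷ zs) h zero    = refl
lift-renames (z ∷ zs) h (suc i) = lift-renames zs h i

module _ (S : Structure ℓ) where

  ⟦renᵗ⟧ : (ρ : Fin m → Fin n) {xs : Vec ∣ S ∣ m} {ys : Vec ∣ S ∣ n} → Renames ρ xs ys →
    ∀ t → ⟦_⟧ S (renᵗ ρ t) ys ≡ ⟦_⟧ S t xs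
  ⟦renᵗ⟧ ρ h (var i)  = h i
  ⟦renᵗ⟧ ρ h 0'       = refl
  ⟦renᵗ⟧ ρ h 1'       = refl
  ⟦renᵗ⟧ ρ h (s +' t) = cong₂ (Structure._+_ S) (⟦renᵗ⟧ ρ h s) (⟦renᵗ⟧ ρ h t)
  ⟦renᵗ⟧ ρ h (s *' t) = cong₂ (Structure._*_ S) (⟦renᵗ⟧ ρ h s) (⟦renᵗ⟧ ρ h t)

  ⊨ren : (ρ : Fin m → Fin n) {xs : Vec ∣ S ∣ m} {ys : Vec ∣ S ∣ n} → Renames ρ xs ys →
    ∀ φ → (S ⊨ ren ρ φ [ ys ]) ⇔ (S ⊨ φ [ xs ])
  ⊨ren ρ h (s ≈' t) = ≡⇒⇔ (cong₂ (Structure._≈_ S) (⟦renᵗ⟧ ρ h s) (⟦renᵗ⟧ ρ h t))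
  ⊨ren ρ h (s <' t) = ≡⇒⇔ (cong₂ (Structure._<_ S) (⟦renᵗ⟧ ρ h s) (⟦renᵗ⟧ ρ h t))
  ⊨ren ρ h (¬' φ)   = ¬-cong-⇔ (⊨ren ρ h φ)
  ⊨ren ρ h (φ ∧' ψ) = ⊨ren ρ h φ ×-⇔ ⊨ren ρ h ψ
  ⊨ren ρ h (φ ∨' ψ) = ⊨ren ρ h φ ⊎-⇔ ⊨ren ρ h ψ
  ⊨ren ρ h (φ ⇒' ψ) = →-cong-⇔ (⊨ren ρ h φ) (⊨ren ρ h ψ)
  ⊨ren ρ h (∀' φ)   = ∀-⇔ λ x → ⊨ren (Fin.lift 1 ρ) (lift-renames (x ∷ []) h) φ
  ⊨ren ρ h (∃' φ)   = ∃-⇔ λ x → ⊨ren (Fin.lift 1 ρ) (lift-renames (x ∷ []) h) φ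

  ⟦weaken⟧ : (t : Term n) (x : ∣ S ∣) (xs : Vec ∣ S ∣ n) →
    ⟦_⟧ S (weaken t) (x ∷ xs) ≡ ⟦_⟧ S t xs
  ⟦weaken⟧ (var i)  x xs = refl
  ⟦weaken⟧ 0'       x xs = refl
  ⟦weaken⟧ 1'       x xs = refl
  ⟦weaken⟧ (s +' t) x xs = cong₂ (Structure._+_ S) (⟦weaken⟧ s x xs) (⟦weaken⟧ t x xs)
  ⟦weaken⟧ (s *' t) x xs = cong₂ (Structure._*_ S) (⟦weaken⟧ s x xs) (⟦weaken⟧ t x xs)

-- The arithmetical hierarchy

Σ⊆Σ⁺ : {φ : Formula m} → IsΣ k φ → IsΣ (suc k) φ
Π⊆Π⁺ : {φ : Formula m} → IsΠ k φ → IsΠ (suc k) φ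
Σ⊆Σ⁺ (Δ₀ d)     = matrix (Δ₀ d)
Σ⊆Σ⁺ (matrix d) = matrix (Π⊆Π⁺ d)
Σ⊆Σ⁺ (ex d)     = ex (Σ⊆Σ⁺ d)
Π⊆Π⁺ (Δ₀ d)     = matrix (Δ₀ d)
Π⊆Π⁺ (matrix d) = matrix (Σ⊆Σ⁺ d)
Π⊆Π⁺ (all d)    = all (Π⊆Π⁺ d)

-- Variable zero is bound innermost, so the block binds exactly the prefix `ys` of an environment
-- `ys ++ xs`.
∀^ : ∀ q → Formula (q +ⁿ m) → Formula m
∀^ zero    φ = φ
∀^ (suc q) φ = ∀^ q (∀' φ)

∃^ : ∀ q → Formula (q +ⁿ m) → Formula m
∃^ zero    φ = φ
∃^ (suc q) φ = ∃^ q (∃' φ)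

∀^-Π : ∀ q {φ : Formula (q +ⁿ m)} → IsΠ (suc k) φ → IsΠ (suc k) (∀^ q φ)
∀^-Π zero    d = d
∀^-Π (suc q) d = ∀^-Π q (all d)

∃^-Σ : ∀ q {φ : Formula (q +ⁿ m)} → IsΣ (suc k) φ → IsΣ (suc k) (∃^ q φ)
∃^-Σ zero    d = d
∃^-Σ (suc q) d = ∃^-Σ q (ex d)

module _ (S : Structure ℓ) where

  ⊨∀^ : ∀ q (φ : Formula (q +ⁿ m)) (xs : Vec ∣ S ∣ m) →
    (S ⊨ ∀^ q φ [ xs ]) ⇔ (∀ ys → S ⊨ φ [ ys ++ xs ])
  ⊨∀^ zero    φ xs = mk⇔ (λ { h [] → h }) (λ h → h [])
  ⊨∀^ (suc q) φ xs = mk⇔ (λ { h (y ∷ ys) → to (⊨∀^ q (∀' φ) xs) h ys y })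
                         (λ h → from (⊨∀^ q (∀' φ) xs) λ ys y → h (y ∷ ys))

  ⊨∃^ : ∀ q (φ : Formula (q +ⁿ m)) (xs : Vec ∣ S ∣ m) →
    (S ⊨ ∃^ q φ [ xs ]) ⇔ (∃ λ ys → S ⊨ φ [ ys ++ xs ])
  ⊨∃^ zero    φ xs = mk⇔ (λ h → [] , h) (λ { ([] , h) → h })
  ⊨∃^ (suc q) φ xs = mk⇔
    (λ h → let ys , y , h' = to (⊨∃^ q (∃' φ) xs) h in y ∷ ys , h')
    (λ { (y ∷ ys , h) → from (⊨∃^ q (∃' φ) xs) (ys , y , h) })

-- Negation and disjunction in prenex form.

module Classical (em : ∀ {a} → ExcludedMiddle a) where

  dne : ¬ ¬ A → A
  dne {A = A} h with em {P = A}
  ... | yes x = x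
  ... | no ¬x = ⊥-elim (h ¬x)

  ¬∀⇒∃¬ : {P : A → Set ℓ} → ¬ (∀ x → P x) → ∃ λ x → ¬ P x
  ¬∀⇒∃¬ h = dne λ g → h λ x → dne λ ¬p → g (x , ¬p)

  -- `¬' φ` leaves the hierarchy once φ has an unbounded quantifier, so negation is the dual prenex
  -- form, read off the derivation of class membership.
  ∼Σ : {φ : Formula m} → IsΣ k φ → Formula m
  ∼Π : {φ : Formula m} → IsΠ k φ → Formula m
  ∼Σ {φ = φ} (Δ₀ d) = ¬' φ
  ∼Σ (matrix d)     = ∼Π d
  ∼Σ (ex d)         = ∀' ∼Σ d
  ∼Π {φ = φ} (Δ₀ d) = ¬' φ
  ∼Π (matrix d)     = ∼Σ d
  ∼Π (all d)        = ∃' ∼Π d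

  ∼Σ-Π : {φ : Formula m} (d : IsΣ k φ) → IsΠ k (∼Σ d)
  ∼Π-Σ : {φ : Formula m} (d : IsΠ k φ) → IsΣ k (∼Π d)
  ∼Σ-Π (Δ₀ d)     = Δ₀ (neg d)
  ∼Σ-Π (matrix d) = matrix (∼Π-Σ d)
  ∼Σ-Π (ex d)     = all (∼Σ-Π d)
  ∼Π-Σ (Δ₀ d)     = Δ₀ (neg d)
  ∼Π-Σ (matrix d) = matrix (∼Σ-Π d)
  ∼Π-Σ (all d)    = ex (∼Π-Σ d)

  ⊨∼Σ : (S : Structure ℓ) {φ : Formula m} (d : IsΣ k φ) (xs : Vec ∣ S ∣ m) →
    (S ⊨ ∼Σ d [ xs ]) ⇔ (¬ (S ⊨ φ [ xs ]))
  ⊨∼Π : (S : Structure ℓ) {φ : Formula m} (d : IsΠ k φ) (xs : Vec ∣ S ∣ m) →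
    (S ⊨ ∼Π d [ xs ]) ⇔ (¬ (S ⊨ φ [ xs ]))
  ⊨∼Σ S (Δ₀ d)     xs = ⇔-id _
  ⊨∼Σ S (matrix d) xs = ⊨∼Π S d xs
  ⊨∼Σ S (ex d)     xs = mk⇔ (λ h (y , g) → to (⊨∼Σ S d (y ∷ xs)) (h y) g)
                            (λ h y → from (⊨∼Σ S d (y ∷ xs)) λ g → h (y , g))
  ⊨∼Π S (Δ₀ d)     xs = ⇔-id _
  ⊨∼Π S (matrix d) xs = ⊨∼Σ S d xs
  ⊨∼Π S (all d)    xs = mk⇔ (λ (y , h) g → to (⊨∼Π S d (y ∷ xs)) h (g y))
    (λ h → let y , g = ¬∀⇒∃¬ h in y , from (⊨∼Π S d (y ∷ xs)) g)

  module Disjunction (S : Structure ℓ) where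

    -- A disjunction of prenex formulas is in general not prenex, so an equivalent formula is built;
    -- the equivalence is asked for in `S` alone.
    record Or (Γ : Formula m → Set) (φ ψ : Formula m) : Set ℓ where
      constructor mkOr
      field
        disj : Formula m
        in-Γ : Γ disj
        ⊨disj : ∀ xs → (S ⊨ disj [ xs ]) ⇔ ((S ⊨ φ [ xs ]) ⊎ (S ⊨ ψ [ xs ]))

    ⊨↑ : (φ : Formula m) (x : ∣ S ∣) (xs : Vec ∣ S ∣ m) →
      (S ⊨ ren suc φ [ x ∷ xs ]) ⇔ (S ⊨ φ [ xs ])
    ⊨↑ φ x xs = ⊨ren S suc (λ _ → refl) φ

    module _ {φ : Formula (suc m)} {ψ : Formula m} where

      Or-∃ˡ : Or (IsΣ (suc k)) φ (ren suc ψ) → Or (IsΣ (suc k)) (∃' φ) ψ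
      Or-∃ˡ (mkOr χ d h) = mkOr (∃' χ) (ex d) λ xs → mk⇔
        (λ (x , c) → [ (λ f → inj₁ (x , f)) , (λ g → inj₂ (to (⊨↑ ψ x xs) g)) ]′ (to (h (x ∷ xs)) c))
        [ (λ (x , f) → x , from (h (x ∷ xs)) (inj₁ f))
        -- The carrier is nonempty: zero is a dummy witness for the quantifier pulled over ψ.
        , (λ g → let x = Structure.0# S in x , from (h (x ∷ xs)) (inj₂ (from (⊨↑ ψ x xs) g))) ]′

      Or-∀ˡ : Or (IsΠ (suc k)) φ (ren suc ψ) → Or (IsΠ (suc k)) (∀' φ) ψ
      Or-∀ˡ (mkOr χ d h) = mkOr (∀' χ) (all d) λ xs → mk⇔
        -- If the disjunction fails then ψ fails, and every instance must come from φ.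
        (λ c → dne λ ¬p → ¬p (inj₁ λ x →
          [ id , (λ g → ⊥-elim (¬p (inj₂ (to (⊨↑ ψ x xs) g)))) ]′ (to (h (x ∷ xs)) (c x))))
        [ (λ f x → from (h (x ∷ xs)) (inj₁ (f x)))
        , (λ g x → from (h (x ∷ xs)) (inj₂ (from (⊨↑ ψ x xs) g))) ]′

    Or-comm : {Γ : Formula m → Set} {φ ψ : Formula m} → Or Γ φ ψ → Or Γ ψ φ
    Or-comm (mkOr χ d h) = mkOr χ d λ xs → mk⇔ swap swap ⇔-∘ h xs

    -- The left prefix is pulled out first, then the right one (`orΠΣ`, `orΣΠ`); once both are down
    -- to their matrices the level drops and the dual case continues.
    orΣ  : ∀ k {φ ψ : Formula m} → IsΣ k φ → IsΣ k ψ → Or (IsΣ k) φ ψ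
    orΠ  : ∀ k {φ ψ : Formula m} → IsΠ k φ → IsΠ k ψ → Or (IsΠ k) φ ψ
    orΠΣ : ∀ k {φ ψ : Formula m} → IsΠ k φ → IsΣ (suc k) ψ → Or (IsΣ (suc k)) φ ψ
    orΣΠ : ∀ k {φ ψ : Formula m} → IsΣ k φ → IsΠ (suc k) ψ → Or (IsΠ (suc k)) φ ψ

    orΣ zero    (Δ₀ d)     (Δ₀ e) = mkOr _ (Δ₀ (or d e)) λ _ → ⇔-id _
    orΣ (suc k) (matrix d) e      = orΠΣ k d e
    orΣ (suc k) (ex d)     e      = Or-∃ˡ (orΣ (suc k) d (ren-Σ suc e))

    orΠΣ k d (matrix e) = let mkOr χ c h = orΠ k d e in mkOr χ (matrix c) h
    orΠΣ k d (ex e)     = Or-comm (Or-∃ˡ (Or-comm (orΠΣ k (ren-Π suc d) e)))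

    orΠ zero    (Δ₀ d)     (Δ₀ e) = mkOr _ (Δ₀ (or d e)) λ _ → ⇔-id _
    orΠ (suc k) (matrix d) e      = orΣΠ k d e
    orΠ (suc k) (all d)    e      = Or-∀ˡ (orΠ (suc k) d (ren-Π suc e))

    orΣΠ k d (matrix e) = let mkOr χ c h = orΣ k d e in mkOr χ (matrix c) h
    orΣΠ k d (all e)    = Or-comm (Or-∀ˡ (Or-comm (orΣΠ k (ren-Σ suc d) e)))

-- Localisation by formulas with parameters.

record Closed (Γ : FormulaClass) : Set where
  field
    ¬-closed : {φ : Formula n} → Γ φ → Γ (¬' φ)
    ∧-closed : {φ ψ : Formula n} → Γ φ → Γ ψ → Γ (φ ∧' ψ)
    ∃<-closed : (t : Term n) {φ : Formula (suc n)} → Γ φ → Γ (∃' (var zero <' weaken t ∧' φ))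
    ren-closed : (ρ : Fin m → Fin n) {φ : Formula m} → Γ φ → Γ (ren ρ φ)

Δ₀-closed : Closed IsΔ₀
Δ₀-closed = record
  { ¬-closed = neg ; ∧-closed = and ; ∃<-closed = ex< ; ren-closed = ren-Δ₀ }

⊤-closed : Closed (λ _ → ⊤)
⊤-closed = _

-- Loc P Q us: below us, one formula of Γ with parameters from M defines both
-- the predicate P of M and the predicate Q of K.
module Localisation (em : ∀ {a} → ExcludedMiddle a) {M K : Structure ℓ} (e : M ⊆ K)
  (Γ : FormulaClass) (Γ-closed : Closed Γ) (elementary : Elementary[ Γ ] e) where

  open _⊆_ e
  open Closed Γ-closed
  open Classical em
  private
    module M = Structure M
    module K = Structure K

  ι-<ᵛ : {xs us : Vec M.Carrier m} → _<ᵛ_ M xs us → _<ᵛ_ K (map ι xs) (map ι us)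
  ι-<ᵛ = Pointwise.map⁺ λ {x} {u} → to (<-⇔ x u)

  ι-<ᵛ⁻ : (xs us : Vec M.Carrier m) → _<ᵛ_ K (map ι xs) (map ι us) → _<ᵛ_ M xs us
  ι-<ᵛ⁻ []       []       []        = []
  ι-<ᵛ⁻ (x ∷ xs) (u ∷ us) (x<u ∷ p) = from (<-⇔ x u) x<u ∷ ι-<ᵛ⁻ xs us p

  -- `inK` covers all points of `K` below the image of `us`, not only images of points of `M`. The
  -- parameters are an index so that two localisations can be given the same ones before they are
  -- combined.
  record LocWith (C : Vec M.Carrier r) (P : Vec M.Carrier m → Set ℓ)
                 (Q : Vec K.Carrier m → Set ℓ) (us : Vec M.Carrier m) : Set ℓ where
    constructor locWith
    field
      δ   : Formula (m +ⁿ r)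
      δ∈Γ : Γ δ
      inM : ∀ xs → _<ᵛ_ M xs us → P xs ⇔ (M ⊨ δ [ xs ++ C ])
      inK : ∀ xs → _<ᵛ_ K xs (map ι us) → Q xs ⇔ (K ⊨ δ [ xs ++ map ι C ])

  record Loc (P : Vec M.Carrier m → Set ℓ) (Q : Vec K.Carrier m → Set ℓ)
             (us : Vec M.Carrier m) : Set ℓ where
    constructor loc
    field
      {arity}   : ℕ
      {params}  : Vec M.Carrier arity
      localised : LocWith params P Q us

  private variable
    P P′ : Vec M.Carrier m → Set ℓ
    Q Q′ : Vec K.Carrier m → Set ℓ

  map-renames : {ρ : Fin m → Fin n} (xs : Vec M.Carrier m) (ys : Vec M.Carrier n) →
    Renames ρ xs ys → Renames ρ (map ι xs) (map ι ys)
  map-renames {ρ = ρ} xs ys h i =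
    trans (lookup-map (ρ i) ι ys) (trans (cong ι (h i)) (sym (lookup-map i ι xs)))

  reparam : {us : Vec M.Carrier m} {C : Vec M.Carrier q} {D : Vec M.Carrier r}
    (ρ : Fin q → Fin r) → Renames ρ C D → LocWith C P Q us → LocWith D P Q us
  reparam {m = m} {C = C} {D} ρ h (locWith δ d hM hK) =
    locWith (ren (Fin.lift m ρ) δ) (ren-closed _ d)
      (λ xs p → ⇔-sym (⊨ren M _ (lift-renames xs h) δ) ⇔-∘ hM xs p)
      (λ xs p → ⇔-sym (⊨ren K _ (lift-renames xs (map-renames C D h)) δ) ⇔-∘ hK xs p)

  Loc-resp : {us : Vec M.Carrier m} → (∀ xs → _<ᵛ_ M xs us → P xs ⇔ P′ xs) →
    (∀ xs → _<ᵛ_ K xs (map ι us) → Q xs ⇔ Q′ xs) → Loc P Q us → Loc P′ Q′ us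
  Loc-resp f g (loc (locWith δ d hM hK)) = loc (locWith δ d
    (λ xs p → hM xs p ⇔-∘ ⇔-sym (f xs p)) (λ xs p → hK xs p ⇔-∘ ⇔-sym (g xs p)))

  Loc-⊨ : {φ : Formula m} {us : Vec M.Carrier m} → Γ φ →
    Loc (λ xs → M ⊨ φ [ xs ]) (λ xs → K ⊨ φ [ xs ]) us
  Loc-⊨ {φ = φ} d = loc {params = []} (locWith (ren (_↑ˡ 0) φ) (ren-closed _ d)
    (λ xs _ → ⇔-sym (⊨ren M _ (lookup-++ˡ xs []) φ))
    (λ xs _ → ⇔-sym (⊨ren K _ (lookup-++ˡ xs []) φ)))

  Loc-¬ : {us : Vec M.Carrier m} → Loc P Q us → Loc (λ xs → ¬ P xs) (λ xs → ¬ Q xs) us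
  Loc-¬ (loc (locWith δ d hM hK)) = loc (locWith (¬' δ) (¬-closed d)
    (λ xs p → ¬-cong-⇔ (hM xs p)) (λ xs p → ¬-cong-⇔ (hK xs p)))

  LocWith-× : {us : Vec M.Carrier m} {C : Vec M.Carrier r} →
    LocWith C P Q us → LocWith C P′ Q′ us →
    LocWith C (λ xs → P xs × P′ xs) (λ xs → Q xs × Q′ xs) us
  LocWith-× (locWith δ d hM hK) (locWith δ′ d′ hM′ hK′) = locWith (δ ∧' δ′) (∧-closed d d′)
    (λ xs p → hM xs p ×-⇔ hM′ xs p) (λ xs p → hK xs p ×-⇔ hK′ xs p)

  Loc-× : {us : Vec M.Carrier m} → Loc P Q us → Loc P′ Q′ us →
    Loc (λ xs → P xs × P′ xs) (λ xs → Q xs × Q′ xs) us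
  Loc-× (loc {params = C} l) (loc {params = D} l′) = loc {params = C ++ D}
    (LocWith-× (reparam (_↑ˡ _) (lookup-++ˡ C D) l) (reparam (_ ↑ʳ_) (lookup-++ʳ C D) l′))

  -- The bound `v` joins the parameters, as variable `m ↑ʳ zero`, which keeps the new quantifier
  -- bounded and the formula in `Γ`.
  Loc-∃ : {v : M.Carrier} {us : Vec M.Carrier m} → Loc P Q (v ∷ us) →
    Loc (λ xs → ∃ λ y → (y M.< v) × P (y ∷ xs)) (λ xs → ∃ λ y → (y K.< ι v) × Q (y ∷ xs)) us
  Loc-∃ {m = m} {P = P} {Q} {v} {us} (loc {params = C} l)
    with locWith δ d hM hK ← reparam {D = v ∷ C} suc (λ _ → refl) l =
    loc {params = v ∷ C}
      (locWith (∃' (var zero <' weaken (var (m ↑ʳ zero)) ∧' δ)) (∃<-closed _ d) inM inK)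
    where
    inM : ∀ xs → _<ᵛ_ M xs us → (∃ λ y → (y M.< v) × P (y ∷ xs)) ⇔
      (∃ λ y → (y M.< lookup (xs ++ v ∷ C) (m ↑ʳ zero)) × (M ⊨ δ [ y ∷ xs ++ v ∷ C ]))
    inM xs p rewrite lookup-++ʳ xs (v ∷ C) zero = mk⇔
      (λ (y , y<v , h) → y , y<v , to (hM (y ∷ xs) (y<v ∷ p)) h)
      (λ (y , y<v , h) → y , y<v , from (hM (y ∷ xs) (y<v ∷ p)) h)
    inK : ∀ xs → _<ᵛ_ K xs (map ι us) → (∃ λ y → (y K.< ι v) × Q (y ∷ xs)) ⇔
      (∃ λ y → (y K.< lookup (xs ++ map ι (v ∷ C)) (m ↑ʳ zero))
             × (K ⊨ δ [ y ∷ xs ++ map ι (v ∷ C) ]))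
    inK xs p rewrite lookup-++ʳ xs (map ι (v ∷ C)) zero = mk⇔
      (λ (y , y<v , h) → y , y<v , to (hK (y ∷ xs) (y<v ∷ p)) h)
      (λ (y , y<v , h) → y , y<v , from (hK (y ∷ xs) (y<v ∷ p)) h)

  Loc-∃^ : (vs : Vec M.Carrier q) {us : Vec M.Carrier m} → Loc P Q (vs ++ us) →
    Loc (λ xs → ∃ λ ys → _<ᵛ_ M ys vs × P (ys ++ xs))
        (λ xs → ∃ λ ys → _<ᵛ_ K ys (map ι vs) × Q (ys ++ xs)) us
  Loc-∃^ [] l = Loc-resp (λ _ _ → mk⇔ (λ h → [] , [] , h) λ { ([] , _ , h) → h })
                         (λ _ _ → mk⇔ (λ h → [] , [] , h) λ { ([] , _ , h) → h }) l
  Loc-∃^ (v ∷ vs) l = Loc-resp (λ _ _ → swap-∃) (λ _ _ → swap-∃) (Loc-∃^ vs (Loc-∃ l))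
    where
    swap-∃ : {X : Set ℓ} {_≺_ : X → X → Set ℓ} {v : X} {vs : Vec X q} {R : Vec X (suc q) → Set ℓ} →
      (∃ λ ys → Pointwise _≺_ ys vs × ∃ λ y → (y ≺ v) × R (y ∷ ys)) ⇔
      (∃ λ ys → Pointwise _≺_ ys (v ∷ vs) × R ys)
    swap-∃ = mk⇔ (λ (ys , p , y , y<v , h) → y ∷ ys , y<v ∷ p , h)
                 (λ { (y ∷ ys , y<v ∷ p , h) → ys , p , y , y<v , h })

  -- The defining formula has its parameters in `M`, so elementarity for `Γ` applies to it.
  Loc-at : {us : Vec M.Carrier m} → Loc P Q us → ∀ {xs} → _<ᵛ_ M xs us → P xs ⇔ Q (map ι xs)
  Loc-at (loc {params = C} (locWith δ d hM hK)) {xs} p =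
    ⇔-sym (hK (map ι xs) (ι-<ᵛ p)) ⇔-∘
    (subst (λ zs → (M ⊨ δ [ xs ++ C ]) ⇔ (K ⊨ δ [ zs ])) (map-++ ι xs C) (elementary δ d (xs ++ C))
      ⇔-∘ hM xs p)

  -- Block form of Loc-at: after quantifying the bounded variables away, evaluate at [].
  Loc-transfer : {us : Vec M.Carrier m} → Loc P Q us →
    (∃ λ xs → _<ᵛ_ M xs us × P xs) ⇔ (∃ λ xs → _<ᵛ_ K xs (map ι us) × Q xs)
  Loc-transfer {us = []} l = mk⇔
    (λ { ([] , [] , h) → [] , [] , to (Loc-at l []) h })
    (λ { ([] , [] , h) → [] , [] , from (Loc-at l []) h })
  Loc-transfer {us = u ∷ us} l = mk⇔
    (λ { (x ∷ xs , x<u ∷ p , h) →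
         let ys , p′ , y , y<u , h′ = to (Loc-transfer (Loc-∃ l)) (xs , p , x , x<u , h)
         in y ∷ ys , y<u ∷ p′ , h′ })
    (λ { (x ∷ xs , x<u ∷ p , h) →
         let ys , p′ , y , y<u , h′ = from (Loc-transfer (Loc-∃ l)) (xs , p , x , x<u , h)
         in y ∷ ys , y<u ∷ p′ , h′ })

  -- A counterexample in `K`, possibly outside `M`, makes a localised existential statement true,
  -- which `Loc-transfer` brings down to `M`.
  Loc-⇒ : {us : Vec M.Carrier m} → Loc P Q us → Loc P′ Q′ us →
    (∀ xs → _<ᵛ_ M xs us → P xs → P′ xs) →
    ∀ xs → _<ᵛ_ K xs (map ι us) → Q xs → Q′ xs
  Loc-⇒ l l′ h xs p q = dne λ ¬q′ →
    let ys , r , g , ¬g′ = from (Loc-transfer (Loc-× l (Loc-¬ l′))) (xs , p , q , ¬q′)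
    in ¬g′ (h ys r g)

-- Weak collection with and without parameters.

module Bounds (M : Structure ℓ) (pa : PA⁻ M) where
  open Structure M
  open PA⁻ pa
  open IsCommutativeSemiring isCommutativeSemiring using (+-identityˡ)

  x<1+x : ∀ x → x < 1# + x
  x<1+x x = proj₂ <-resp-≈ (+-identityˡ x) (+-monoˡ-< x 0<1)

  xs<1+xs : (xs : Vec Carrier n) → _<ᵛ_ M xs (map (1# +_) xs)
  xs<1+xs []       = []
  xs<1+xs (x ∷ xs) = x<1+x x ∷ xs<1+xs xs

  d⇒minus : Coll-w-d M (IsΣ k) → Coll-w-minus M (IsΣ k)
  d⇒minus coll {p} {q} φ d h us =
    let vs , b = coll {r = 0} φ′ (ren-Σ _ d) (λ { [] xs → let ys , g = h xs in ys , from (⊨φ′ ys xs) g }) [] us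
    in vs , λ xs p → let ys , ys<vs , g = b xs p in ys , ys<vs , to (⊨φ′ ys xs) g
    where
    φ′ : Formula (q +ⁿ (p +ⁿ 0))
    φ′ = ren (Fin.lift q (_↑ˡ 0)) φ
    ⊨φ′ : ∀ ys xs → (M ⊨ φ′ [ ys ++ (xs ++ []) ]) ⇔ (M ⊨ φ [ ys ++ xs ])
    ⊨φ′ ys xs = ⊨ren M _ (lift-renames ys (lookup-++ˡ xs [])) φ

  -- Parameters become further universal variables: `zs` lies below `map (1# +_) zs`, and a bound
  -- for all tuples below the latter serves for `zs`.
  minus⇒d : Coll-w-minus M (IsΣ k) → Coll-w-d M (IsΣ k)
  minus⇒d coll {p} {q} {r} φ d h zs us =
    let vs , b = coll {p +ⁿ r} φ d h′ (us ++ map (1# +_) zs)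
    in vs , λ xs xs<us → b (xs ++ zs) (Pointwise.++⁺ xs<us (xs<1+xs zs))
    where
    h′ : ∀ ws → ∃ λ ys → M ⊨ φ [ ys ++ ws ]
    h′ ws with xs , zs , refl ← splitAt p ws = h zs xs

-- Collection that returns a bound also where no witness exists.
StrongColl : (M : Structure ℓ) → Formula (suc m) → Set ℓ
StrongColl M φ = ∀ us → ∃ λ v → ∀ xs → _<ᵛ_ M xs us →
  (∃ λ y → M ⊨ φ [ y ∷ xs ]) → ∃ λ y → Structure._<_ M y v × (M ⊨ φ [ y ∷ xs ])

-- The supremum of M in N.

module Supremum {M N : Structure ℓ} (paN : PA⁻ N) (e : M ⊆ N) where

  open _⊆_ e
  private
    module N = Structure N
    module M = Structure M
  open PA⁻ paN
  open IsCommutativeSemiring isCommutativeSemiring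
    using (isEquivalence; +-assoc; +-identityˡ; +-comm; *-assoc; *-identityˡ; *-comm; distribʳ; zeroˡ)
  open IsEquivalence isEquivalence using () renaming (sym to ≈-sym; trans to ≈-trans)
  open IsStrictTotalOrder isStrictTotalOrder using (irrefl; compare) renaming (trans to <-trans)

  S : Structure ℓ
  S = sup paN e
  module S = Structure S

  below : ∀ {x} (y : S.Carrier) → x N.≤ proj₁ y → ∃ λ b → x N.≤ ι b
  below (y , b , y≤b) x≤y = b , ≤-trans paN x≤y y≤b

  sup-PA⁻ : PA⁻ S
  sup-PA⁻ = record
    { isCommutativeSemiring = isCommutativeSemiringˡ record
      { +-isCommutativeMonoid = isCommutativeMonoidˡ record
        { isSemigroup = record
          { isMagma = record { isEquivalence = S.isEquivalence ; ∙-cong = N.+-cong }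
          ; assoc = λ x y z → +-assoc (proj₁ x) (proj₁ y) (proj₁ z) }
        ; identityˡ = λ x → +-identityˡ (proj₁ x)
        ; comm = λ x y → +-comm (proj₁ x) (proj₁ y) }
      ; *-isCommutativeMonoid = isCommutativeMonoidˡ record
        { isSemigroup = record
          { isMagma = record { isEquivalence = S.isEquivalence ; ∙-cong = N.*-cong }
          ; assoc = λ x y z → *-assoc (proj₁ x) (proj₁ y) (proj₁ z) }
        ; identityˡ = λ x → *-identityˡ (proj₁ x)
        ; comm = λ x y → *-comm (proj₁ x) (proj₁ y) }
      ; distribʳ = λ x y z → distribʳ (proj₁ x) (proj₁ y) (proj₁ z)
      ; zeroˡ = λ x → zeroˡ (proj₁ x) }
    ; isStrictTotalOrder = record
      { isStrictPartialOrder = record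
        { isEquivalence = S.isEquivalence
        ; irrefl = irrefl
        ; trans = <-trans
        ; <-resp-≈ = S.<-resp-≈ }
      ; compare = λ x y → compare (proj₁ x) (proj₁ y) }
    ; +-monoˡ-< = λ z → +-monoˡ-< (proj₁ z)
    ; *-monoˡ-< = λ z → *-monoˡ-< (proj₁ z)
    -- The difference stays in the supremum, as z ≤ x + z ≈ y.
    ; subtraction = λ {x} {y} x<y → let z , x+z≈y = subtraction x<y in
        (z , below y (≤-trans paN (inj₂ (≈-sym (+-identityˡ z)))
          (≤-trans paN (+-monoˡ-≤ paN z (0≤ (proj₁ x))) (inj₂ x+z≈y)))) , x+z≈y
    ; 0<1 = 0<1
    ; discrete = discrete
    ; 0≤ = λ x → 0≤ (proj₁ x) }

  ⟦⟧-proj₁ : (t : Term n) (xs : Vec S.Carrier n) → proj₁ (⟦_⟧ S t xs) ≡ ⟦_⟧ N t (map proj₁ xs)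
  ⟦⟧-proj₁ (var i)  xs = sym (lookup-map i proj₁ xs)
  ⟦⟧-proj₁ 0'       xs = refl
  ⟦⟧-proj₁ 1'       xs = refl
  ⟦⟧-proj₁ (s +' t) xs = cong₂ N._+_ (⟦⟧-proj₁ s xs) (⟦⟧-proj₁ t xs)
  ⟦⟧-proj₁ (s *' t) xs = cong₂ N._*_ (⟦⟧-proj₁ s xs) (⟦⟧-proj₁ t xs)

  module Bounded (t : Term n) (xs : Vec S.Carrier n) where

    bound-N : ∀ y → ⟦_⟧ N (weaken t) (y ∷ map proj₁ xs) ≡ proj₁ (⟦_⟧ S t xs)
    bound-N y = trans (⟦weaken⟧ N t y (map proj₁ xs)) (sym (⟦⟧-proj₁ t xs))

    bound-S : ∀ y → proj₁ (⟦_⟧ S (weaken t) (y ∷ xs)) ≡ proj₁ (⟦_⟧ S t xs)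
    bound-S y = cong proj₁ (⟦weaken⟧ S t y xs)

    in-N : ∀ y → proj₁ y N.< proj₁ (⟦_⟧ S (weaken t) (y ∷ xs)) →
      proj₁ y N.< ⟦_⟧ N (weaken t) (proj₁ y ∷ map proj₁ xs)
    in-N y = subst (proj₁ y N.<_) (trans (bound-S y) (sym (bound-N (proj₁ y))))

    in-S : ∀ y → proj₁ y N.< ⟦_⟧ N (weaken t) (proj₁ y ∷ map proj₁ xs) →
      proj₁ y N.< proj₁ (⟦_⟧ S (weaken t) (y ∷ xs))
    in-S y = subst (proj₁ y N.<_) (trans (bound-N (proj₁ y)) (sym (bound-S y)))

    element : ∀ y → y N.< ⟦_⟧ N (weaken t) (y ∷ map proj₁ xs) → S.Carrier
    element y y<t = y , below (⟦_⟧ S t xs) (inj₁ (subst (y N.<_) (bound-N y) y<t))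

  -- The supremum is closed downwards in `N`, so a bounded quantifier ranges over the same elements
  -- in both.
  sup-Δ₀ : Elementary[ IsΔ₀ ] (sup⊆ paN e)
  sup-Δ₀ _ (eq s t)  xs = ≡⇒⇔ (cong₂ N._≈_ (⟦⟧-proj₁ s xs) (⟦⟧-proj₁ t xs))
  sup-Δ₀ _ (lt s t)  xs = ≡⇒⇔ (cong₂ N._<_ (⟦⟧-proj₁ s xs) (⟦⟧-proj₁ t xs))
  sup-Δ₀ _ (neg d)   xs = ¬-cong-⇔ (sup-Δ₀ _ d xs)
  sup-Δ₀ _ (and d c) xs = sup-Δ₀ _ d xs ×-⇔ sup-Δ₀ _ c xs
  sup-Δ₀ _ (or d c)  xs = sup-Δ₀ _ d xs ⊎-⇔ sup-Δ₀ _ c xs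
  sup-Δ₀ _ (imp d c) xs = →-cong-⇔ (sup-Δ₀ _ d xs) (sup-Δ₀ _ c xs)
  sup-Δ₀ _ (all< t {φ} d) xs = mk⇔
    (λ h y y<t → let y′ = element y y<t in to (sup-Δ₀ φ d (y′ ∷ xs)) (h y′ (in-S y′ y<t)))
    (λ h y y<t → from (sup-Δ₀ φ d (y ∷ xs)) (h (proj₁ y) (in-N y y<t)))
    where open Bounded t xs
  sup-Δ₀ _ (ex< t {φ} d) xs = mk⇔
    (λ (y , y<t , h) → proj₁ y , in-N y y<t , to (sup-Δ₀ φ d (y ∷ xs)) h)
    (λ (y , y<t , h) → let y′ = element y y<t in y′ , in-S y′ y<t , from (sup-Δ₀ φ d (y′ ∷ xs)) h)
    where open Bounded t xs

  M⊆S : M ⊆ S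
  M⊆S = record
    { ι = λ x → ι x , x , inj₂ (IsEquivalence.refl isEquivalence)
    ; isSemiringMonomorphism = record
      { isSemiringHomomorphism = record
        { isNearSemiringHomomorphism = record
          { +-isMonoidHomomorphism = record
            { isMagmaHomomorphism = record
              { isRelHomomorphism = record { cong = ⟦⟧-cong }
              ; homo = +-homo
              }
            ; ε-homo = 0#-homo
            }
          ; *-homo = *-homo
          }
        ; 1#-homo = 1#-homo
        }
      ; injective = injective
      }
    ; <-⇔ = <-⇔
    }
    where open SemiringMorphisms.IsSemiringMonomorphism isSemiringMonomorphism

  map-ι : (xs : Vec M.Carrier n) → map proj₁ (map (_⊆_.ι M⊆S) xs) ≡ map ι xs
  map-ι xs = sym (map-∘ proj₁ (_⊆_.ι M⊆S) xs)

  M≺S-Δ₀ : Elementary[ IsΔ₀ ] e → Elementary[ IsΔ₀ ] M⊆S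
  M≺S-Δ₀ h φ d xs =
    ⇔-sym (subst (λ ys → (S ⊨ φ [ xs′ ]) ⇔ (N ⊨ φ [ ys ])) (map-ι xs) (sup-Δ₀ φ d xs′)) ⇔-∘ h φ d xs
    where xs′ = map (_⊆_.ι M⊆S) xs

  -- Membership gives only x ≤ b whereas cofinality is strict, hence the bound 1 + b.
  M⊆S-cofinal : PA⁻ M → Cofinal M⊆S
  M⊆S-cofinal paM (x , b , x≤b) = b′ , x<b′ x≤b
    where
    b′ = M.1# M.+ b
    b<b′ : ι b N.< ι b′
    b<b′ = to (<-⇔ b b′) (Bounds.x<1+x M paM b)
    x<b′ : x N.≤ ι b → x N.< ι b′
    x<b′ (inj₁ x<b) = <-trans x<b b<b′
    x<b′ (inj₂ x≈b) = proj₂ N.<-resp-≈ (≈-sym x≈b) b<b′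

-- From collection to conditions on extensions.

module WeakCollection (em : ∀ {a} → ExcludedMiddle a) where
  open Classical em

  coll-mono : {M : Structure ℓ} → Coll-w-minus M (IsΣ (suc k)) → Coll-w-minus M (IsΣ k)
  coll-mono coll φ d = coll φ (Σ⊆Σ⁺ d)

  -- Collection for φ(x,y) ∨ ¬∃y′ φ(x,y′), of which every x has a witness y.
  strongColl : (M : Structure ℓ) → Coll-w-minus M (IsΣ (suc k)) →
    {φ : Formula (suc m)} → IsΣ k φ → IsΣ k (∃' φ) → StrongColl M φ
  strongColl {k = k} M coll {φ} d d∃ us = v , λ xs p (y , g) → bounded xs p y g
    where
    open Disjunction M
    -- The negation is Πₖ, so the disjunction is Σₖ₊₁: collection is spent one level above φ.
    open Or (orΣ (suc k) (Σ⊆Σ⁺ d) (matrix (ren-Π suc (∼Σ-Π d∃))))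
    none : ∀ y xs → (M ⊨ ren suc (∼Σ d∃) [ y ∷ xs ]) ⇔ (¬ ∃ λ y → M ⊨ φ [ y ∷ xs ])
    none y xs = ⊨∼Σ M d∃ xs ⇔-∘ ⊨↑ (∼Σ d∃) y xs
    total : ∀ xs → ∃ λ (ys : Vec ∣ M ∣ 1) → M ⊨ disj [ ys ++ xs ]
    total xs with em {P = ∃ λ y → M ⊨ φ [ y ∷ xs ]}
    ... | yes (y , g) = y ∷ [] , from (⊨disj (y ∷ xs)) (inj₁ g)
    ... | no ¬g = let y = Structure.0# M in
      y ∷ [] , from (⊨disj (y ∷ xs)) (inj₂ (from (none y xs) ¬g))
    collected = coll {q = 1} disj in-Γ total us
    v = Vec.head (proj₁ collected)
    bounded : ∀ xs → _<ᵛ_ M xs us → ∀ y → M ⊨ φ [ y ∷ xs ] →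
      ∃ λ y → Structure._<_ M y v × (M ⊨ φ [ y ∷ xs ])
    bounded xs p y g with proj₁ collected | proj₂ collected xs p
    ... | v ∷ [] | y′ ∷ [] , y′<v ∷ [] , h = y′ , y′<v ,
      [ id , (λ h′ → ⊥-elim (to (none y′ xs) h′ (y , g))) ]′ (to (⊨disj (y′ ∷ xs)) h)

  module Cofinality {M K : Structure ℓ} (e : M ⊆ K) (e-Δ₀ : Elementary[ IsΔ₀ ] e)
    (cofinal : Cofinal e) where

    open _⊆_ e
    open Localisation em e IsΔ₀ Δ₀-closed e-Δ₀
    private
      module M = Structure M
      module K = Structure K

    bound : (xs : Vec K.Carrier m) → ∃ λ us → _<ᵛ_ K xs (map ι us)
    bound []       = [] , []
    bound (x ∷ xs) = let u , x<u = cofinal x ; us , p = bound xs in u ∷ us , x<u ∷ p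

    above : (xs : Vec M.Carrier m) → ∃ λ us → _<ᵛ_ M xs us
    above xs = let us , p = bound (map ι xs) in us , ι-<ᵛ⁻ xs us p

    Localisable : Formula m → Set ℓ
    Localisable φ = ∀ us → Loc (λ xs → M ⊨ φ [ xs ]) (λ xs → K ⊨ φ [ xs ]) us

    -- A witness in K for x < u lies below some w ∈ M; that it may be replaced by one
    -- below v is a localised statement, true in M and so in K.
    localise-∃ : (φ : Formula (suc m)) → StrongColl M φ → Localisable φ → Localisable (∃' φ)
    localise-∃ φ sc l us =
      let v , strong = sc us in
      Loc-resp
        (λ xs p → mk⇔ (λ (y , _ , g) → y , g) (strong xs p))
        (λ xs p → mk⇔ (λ (y , _ , g) → y , g) λ (y , g) →
          let w , y<w = cofinal y
          in Loc-⇒ (Loc-∃ (l (w ∷ us))) (Loc-∃ (l (v ∷ us)))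
               (λ xs p (y , _ , g) → strong xs p (y , g)) xs p (y , y<w , g))
        (Loc-∃ (l (v ∷ us)))

    -- Strong collection bounds each ∃ in turn; a ∀ is handled as ¬∃¬, where the dual form `∼Π d` is
    -- the Σₖ formula to be collected.
    localise-Σ : Coll-w-minus M (IsΣ (suc k)) → {φ : Formula m} → IsΣ k φ → Localisable φ
    localise-Π : Coll-w-minus M (IsΣ (suc k)) → {φ : Formula m} → IsΠ k φ → Localisable φ
    localise-Σ coll (Δ₀ d)     us = Loc-⊨ d
    localise-Σ coll (matrix d) us = localise-Π (coll-mono {M = M} coll) d us
    localise-Σ coll (ex {φ = φ} d) us = localise-∃ φ (strongColl M coll d (ex d)) (localise-Σ coll d) us
    localise-Π coll (Δ₀ d)     us = Loc-⊨ d
    localise-Π coll (matrix d) us = localise-Σ (coll-mono {M = M} coll) d us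
    localise-Π coll (all d)    us = Loc-resp
      (λ xs _ → ¬∃¬ M (λ y → ⊨∼Π M d (y ∷ xs)))
      (λ xs _ → ¬∃¬ K (λ y → ⊨∼Π K d (y ∷ xs)))
      (Loc-¬ (localise-∃ (∼Π d) (strongColl M coll (∼Π-Σ d) (ex (∼Π-Σ d))) (λ us → Loc-resp
        (λ xs _ → ⇔-sym (⊨∼Π M d xs)) (λ xs _ → ⇔-sym (⊨∼Π K d xs)) (Loc-¬ (localise-Π coll d us))) us))
      where
      ¬∃¬ : (S : Structure ℓ) {P N : ∣ S ∣ → Set ℓ} → (∀ y → N y ⇔ (¬ P y)) → (¬ ∃ N) ⇔ (∀ y → P y)
      ¬∃¬ S h = mk⇔ (λ f y → dne λ ¬p → f (y , from (h y) ¬p)) (λ f (y , n) → to (h y) n (f y))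

    module _ (coll : Coll-w-minus M (IsΣ (suc k))) where

      -- The block ys collects the quantifiers already stripped from σ: collection has
      -- to bound all of them at once.
      total-up : ∀ q {σ : Formula (q +ⁿ m)} → IsΣ (suc k) σ →
        (∀ (xs : Vec M.Carrier m) → ∃ λ (ys : Vec M.Carrier q) → M ⊨ σ [ ys ++ xs ]) →
        ∀ (xs : Vec K.Carrier m) → ∃ λ (ys : Vec K.Carrier q) → K ⊨ σ [ ys ++ xs ]
      total-up q (ex d) h xs
        with y ∷ ys , g ← total-up (suc q) d (λ xs → let ys , y , g = h xs in y ∷ ys , g) xs =
        ys , y , g
      total-up q {σ} (matrix d) h xs = dne λ none →
        -- The failure to have witnesses below `vs` is localised below `us`, so a failure in `K`
        -- would come down to `M`, against the choice of `vs`.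
        let us , p = bound xs
            vs , b = coll {q = q} σ (matrix d) h us
            xs′ , p′ , ¬g = from (Loc-transfer (Loc-¬ (Loc-∃^ vs (localise-Π coll d (vs ++ us)))))
                              (xs , p , λ (ys , _ , g) → none (ys , g))
        in ¬g (b xs′ p′)

      -- By cofinality a witness in `K` lies below some `vs` from `M`, and having one below `vs` is
      -- localised, hence absolute at points of `M`.
      witness-down : ∀ q {σ : Formula (q +ⁿ m)} → IsΣ (suc k) σ → (xs : Vec M.Carrier m) →
        (∃ λ (ys : Vec K.Carrier q) → K ⊨ σ [ ys ++ map ι xs ]) →
        ∃ λ (ys : Vec M.Carrier q) → M ⊨ σ [ ys ++ xs ]
      witness-down q (ex d) xs (ys , y , g)
        with y′ ∷ ys′ , g′ ← witness-down (suc q) d xs (y ∷ ys , g) = ys′ , y′ , g′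
      witness-down q (matrix d) xs (ys , g) =
        let us , p = above xs
            vs , ys<vs = bound ys
            ys′ , _ , g′ = from (Loc-at (Loc-∃^ vs (localise-Π coll d (vs ++ us))) p) (ys , ys<vs , g)
        in ys′ , g′

      -- Witnesses are mapped along `ι`. The Πₖ₊₁ matrix goes up because its negation, a Σₖ₊₁
      -- formula, comes down by `witness-down`.
      Σ-up : {φ : Formula m} → IsΣ (suc (suc k)) φ → ∀ xs →
        (M ⊨ φ [ xs ]) → K ⊨ φ [ map ι xs ]
      Σ-up (ex d) xs (y , g) = ι y , Σ-up d (y ∷ xs) g
      Σ-up (matrix d) xs g = dne λ ¬g →
        to (⊨∼Π M d xs) (down (witness-down 0 (∼Π-Σ d) xs ([] , from (⊨∼Π K d (map ι xs)) ¬g))) g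
        where
        down : (∃ λ ys → M ⊨ ∼Π d [ ys ++ xs ]) → M ⊨ ∼Π d [ xs ]
        down ([] , h) = h

      -- Free variables stay general so that quantifiers can be stripped; refuting the matrix
      -- everywhere is then the totality of a Σₖ₊₁ formula, which `total-up` lifts.
      unsatisfied-up : {φ : Formula m} → IsΣ (suc (suc k)) φ →
        (∀ xs → ¬ (M ⊨ φ [ xs ])) → ∀ xs → ¬ (K ⊨ φ [ xs ])
      unsatisfied-up (ex d) h xs (y , g) =
        unsatisfied-up d (λ { (y ∷ xs) g → h xs (y , g) }) (y ∷ xs) g
      unsatisfied-up (matrix d) h xs g
        with [] , h′ ← total-up 0 (∼Π-Σ d) (λ xs → [] , from (⊨∼Π M d xs) (h xs)) xs =
        to (⊨∼Π K d xs) h′ g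

      coll⇒≡Σ : M ≡Σ[ suc (suc k) ] K
      coll⇒≡Σ φ d = mk⇔ (Σ-up d []) λ g → dne λ ¬g →
        unsatisfied-up d (λ { [] → ¬g }) [] g

  coll⇒COF : (M : Structure ℓ) → Coll-w-minus M (IsΣ (suc k)) → COF≡ M (suc (suc k))
  coll⇒COF M coll K _ e e-Δ₀ cofinal = Cofinality.coll⇒≡Σ e e-Δ₀ cofinal coll

  -- On the elements of the supremum S, Σₖ formulas are localised in M and S;
  -- that φ agrees with its localisation δ below us transfers from M to N, where δ
  -- is absolute between S and N.
  coll⇒end : (M : Structure ℓ) → PA⁻ M → Coll-w-minus M (IsΣ (suc k)) → end M k
  coll⇒end M paM coll N paN e elementary φ d xs = S⇔N (localise-Σ coll d us)
    where
    open Supremum paN e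
    open Cofinality M⊆S (M≺S-Δ₀ λ φ _ → elementary φ _) (M⊆S-cofinal paM)
    module S/M = Localisation em M⊆S IsΔ₀ Δ₀-closed (M≺S-Δ₀ λ φ _ → elementary φ _)
    module N/M = Localisation em e (λ _ → ⊤) ⊤-closed elementary
    open _⊆_ e using (ι)
    us = proj₁ (bound xs)
    xs<us : _<ᵛ_ S xs (map (_⊆_.ι M⊆S) us)
    xs<us = proj₂ (bound xs)
    xs<us-N : _<ᵛ_ N (map proj₁ xs) (map ι us)
    xs<us-N = subst (_<ᵛ_ N (map proj₁ xs)) (map-ι us) (Pointwise.map⁺ id xs<us)

    S⇔N : S/M.Loc (λ xs → M ⊨ φ [ xs ]) (λ xs → S ⊨ φ [ xs ]) us →
      (S ⊨ φ [ xs ]) ⇔ (N ⊨ φ [ map proj₁ xs ])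
    S⇔N (S/M.loc {params = C} (S/M.locWith δ δ-Δ₀ inM inS)) =
      mk⇔ (N/M.Loc-⇒ δ-loc φ-loc (λ xs p → from (inM xs p)) (map proj₁ xs) xs<us-N)
          (N/M.Loc-⇒ φ-loc δ-loc (λ xs p → to (inM xs p)) (map proj₁ xs) xs<us-N)
      ⇔-∘ (subst (λ zs → (S ⊨ δ [ xs ++ C′ ]) ⇔ (N ⊨ δ [ zs ])) params-in-N (sup-Δ₀ δ δ-Δ₀ (xs ++ C′))
      ⇔-∘ inS xs xs<us)
      where
      C′ = map (_⊆_.ι M⊆S) C
      params-in-N : map proj₁ (xs ++ C′) ≡ map proj₁ xs ++ map ι C
      params-in-N = trans (map-++ proj₁ xs C′) (cong (map proj₁ xs ++_) (map-ι C))
      φ-loc : N/M.Loc (λ xs → M ⊨ φ [ xs ]) (λ xs → N ⊨ φ [ xs ]) us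
      φ-loc = N/M.Loc-⊨ {φ = φ} _
      δ-loc : N/M.Loc (λ xs → M ⊨ δ [ xs ++ C ]) (λ xs → N ⊨ δ [ xs ++ map ι C ]) us
      δ-loc = N/M.loc (N/M.locWith δ _ (λ _ _ → ⇔-id _) (λ _ _ → ⇔-id _))

  -- The supremum is cofinal over `M`, and `M` is Δ₀-elementary in it because both are in `N`.
  COF⇒cof : (M : Structure ℓ) → PA⁻ M → COF≡ M k → cof≡ M k
  COF⇒cof M paM COF N paN e elementary =
    COF S sup-PA⁻ M⊆S (M≺S-Δ₀ λ φ _ → elementary φ _) (M⊆S-cofinal paM)
    where open Supremum paN e

-- Ultrafilters

record IsFilter {I : Set ℓ} (_∈F : (I → Set ℓ) → Set a) : Set (lsuc ℓ ⊔ a) where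
  field
    mono      : {X Y : I → Set ℓ} → (∀ i → X i → Y i) → X ∈F → Y ∈F
    intersect : {X Y : I → Set ℓ} → X ∈F → Y ∈F → (λ i → X i × Y i) ∈F
    inhabited : {X : I → Set ℓ} → X ∈F → ∃ X
    nonempty  : ∃ _∈F

-- Zermelo's proof: the filters obtained from 𝓑 by iterating `step`, which decides one
-- more set, and taking unions form a chain, whose union is a fixed point of `step`.
-- Families are Bool-valued, so that the union has the same universe level as
-- its members and families with the same members are equal.
module Ultrafilter (em : ∀ {a} → ExcludedMiddle a) (ext : ∀ {a b} → Extensionality a b)
  {I : Set ℓ} (𝓑 : (I → Set ℓ) → Set ℓ) (𝓑-filter : IsFilter 𝓑) where

  open Classical em
  open IsFilter

  Family : Set (lsuc ℓ)
  Family = (I → Set ℓ) → Bool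

  private variable
    F G H : Family
    X Y : I → Set ℓ

  infix 4 _∈_ _≼_
  _∈_ : (I → Set ℓ) → Family → Set
  X ∈ F = T (F X)

  _≼_ : Family → Family → Set (lsuc ℓ)
  F ≼ G = ∀ X → X ∈ F → X ∈ G

  ⟪_⟫ : ((I → Set ℓ) → Set a) → Family
  ⟪ Φ ⟫ X = isYes (em {P = Φ X})

  T-antisym : (x y : Bool) → (T x → T y) → (T y → T x) → x ≡ y
  T-antisym false false _ _ = refl
  T-antisym false true  _ g = ⊥-elim (g _)
  T-antisym true  false f _ = ⊥-elim (f _)
  T-antisym true  true  _ _ = refl

  ≼-antisym : F ≼ G → G ≼ F → F ≡ G
  ≼-antisym F≼G G≼F = ext λ X → T-antisym _ _ (F≼G X) (G≼F X)

  Undecided : Family → (I → Set ℓ) → Set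
  Undecided F X = (¬ X ∈ F) × (¬ (λ i → ¬ X i) ∈ F)

  -- The filter generated by `F` and `X`, when `F` is a filter.
  adjoin : (I → Set ℓ) → Family → Family
  adjoin X F = ⟪ (λ Y → ∃ λ Z → Z ∈ F × (∀ i → Z i → X i → Y i)) ⟫

  stepBy : ∀ F → Dec (∃ (Undecided F)) → Family
  stepBy F (yes (X , _)) = adjoin X F
  stepBy F (no _)        = F

  step : Family → Family
  step F = stepBy F em

  stepBy-increasing : ∀ d → F ≼ stepBy F d
  stepBy-increasing (yes _) _ X∈F = fromWitness (_ , X∈F , λ _ z _ → z)
  stepBy-increasing (no _)  _ X∈F = X∈F

  step-increasing : F ≼ step F
  step-increasing = stepBy-increasing em

  stepBy-filter : ∀ d → IsFilter (_∈ F) → IsFilter (_∈ stepBy F d)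
  stepBy-filter (no _) f = f
  stepBy-filter (yes (X , _ , ∁X∉F)) f = record
    { mono = λ Y⊆Y′ Y∈ → let Z , Z∈F , h = toWitness Y∈ in
        fromWitness (Z , Z∈F , λ i z x → Y⊆Y′ i (h i z x))
    ; intersect = λ Y∈ Y′∈ → let Z , Z∈F , h = toWitness Y∈ ; Z′ , Z′∈F , h′ = toWitness Y′∈ in
        fromWitness (_ , intersect f Z∈F Z′∈F , λ i (z , z′) x → h i z x , h′ i z′ x)
    -- If `Y` were empty, the member `Z` of `F` would lie in the complement of `X`, which `F` does
    -- not contain.
    ; inhabited = λ Y∈ → let Z , Z∈F , h = toWitness Y∈ in
        dne λ empty → ∁X∉F (mono f (λ i z x → empty (i , h i z x)) Z∈F)
    ; nonempty = let Y , Y∈F = nonempty f in Y , fromWitness (Y , Y∈F , λ _ y _ → y)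
    }

  -- Adjoining an undecided `X` makes `X` a member, so a fixed point leaves nothing undecided.
  stepBy-decides : ∀ d → IsFilter (_∈ F) → stepBy F d ≼ F → ∀ X → ¬ Undecided F X
  stepBy-decides (no none) f _ X u = none (X , u)
  stepBy-decides (yes (X , X∉F , _)) f fixed _ _ =
    let Z , Z∈F = nonempty f in X∉F (fixed X (fromWitness (Z , Z∈F , λ _ _ x → x)))

  -- `𝓑` is joined in so that the empty union is `𝓑`, the start of the tower.
  ⋃ : (Family → Bool) → Family
  ⋃ 𝓖 = ⟪ (λ X → 𝓑 X ⊎ ∃ λ F → T (𝓖 F) × X ∈ F) ⟫

  data Tower : Family → Set (lsuc ℓ) where
    next  : Tower F → Tower (step F)
    limit : ∀ 𝓖 → (∀ F → T (𝓖 F) → Tower F) → Tower (⋃ 𝓖)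

  𝓑≼ : Tower F → 𝓑 X → X ∈ F
  𝓑≼ {X = X} (next {F} t) b = step-increasing {F} X (𝓑≼ t b)
  𝓑≼ (limit 𝓖 h) b = fromWitness (inj₁ b)

  ⋃-upper : ∀ {𝓖} → T (𝓖 F) → F ≼ ⋃ 𝓖
  ⋃-upper g _ X∈F = fromWitness (inj₂ (_ , g , X∈F))

  ⋃-least : ∀ {𝓖} → Tower H → (∀ F → T (𝓖 F) → F ≼ H) → ⋃ 𝓖 ≼ H
  ⋃-least t h X X∈ with toWitness X∈
  ... | inj₁ b             = 𝓑≼ t b
  ... | inj₂ (F , g , X∈F) = h F g X X∈F

  -- The extreme points of the Bourbaki-Witt argument; `¬ (G ≼ F)` expresses that `F` is strictly
  -- below `G`.
  Extreme : Family → Set (lsuc ℓ)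
  Extreme G = ∀ {F} → Tower F → F ≼ G → ¬ (G ≼ F) → step F ≼ G

  -- `step` depends on a choice and need not be monotone; but families with the same members are
  -- equal by extensionality.
  step-cong-≼ : F ≼ G → G ≼ F → step F ≼ step G
  step-cong-≼ {F} {G} F≼G G≼F X = subst (λ H → X ∈ step H) (≼-antisym {F} {G} F≼G G≼F)

  -- Induction on the tower of `F`: at a successor, extremeness of `G` excludes a jump past `G`; a
  -- union stays below `G` unless some member is already above `step G`.
  compare : Tower G → Extreme G → Tower F → F ≼ G ⊎ step G ≼ F
  compare {G} s x (next {F} t) with compare s x t
  ... | inj₂ q = inj₂ λ X X∈ → step-increasing {F} X (q X X∈)
  ... | inj₁ q with em {P = G ≼ F}
  ...   | yes r = inj₂ (step-cong-≼ r q)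
  ...   | no ¬r = inj₁ (x t q ¬r)
  compare {G} s x (limit 𝓖 h) with em {P = ∃ λ F → T (𝓖 F) × step G ≼ F}
  ... | yes (F , g , q) = inj₂ λ X X∈ → ⋃-upper {F} {𝓖} g X (q X X∈)
  ... | no none = inj₁ (⋃-least {𝓖 = 𝓖} s λ F g → case compare s x (h F g) of λ where
          (inj₁ q) → q
          (inj₂ q) → ⊥-elim (none (F , g , q)))

  -- Induction on the tower of `G`. A union not contained in `F` has a member not contained in `F`,
  -- whose own extremeness settles the claim.
  extreme : Tower G → Extreme G
  extreme (next {G} s) {F} t q ¬r with compare s (extreme s) t
  ... | inj₂ r = ⊥-elim (¬r r)
  ... | inj₁ F≼G with em {P = G ≼ F}
  ...   | yes G≼F = step-cong-≼ F≼G G≼F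
  ...   | no ¬G≼F = λ X X∈ → step-increasing {G} X (extreme s t F≼G ¬G≼F X X∈)
  extreme (limit 𝓖 h) {F} t q ¬r with em {P = ∃ λ G → T (𝓖 G) × ¬ (G ≼ F)}
  ... | no none = ⊥-elim (¬r (⋃-least {𝓖 = 𝓖} t λ G g → dne λ ¬G≼F → none (G , g , λ r → ¬G≼F r)))
  ... | yes (G , g , ¬G≼F) with compare (h G g) (extreme (h G g)) t
  ...   | inj₁ F≼G = λ X X∈ → ⋃-upper {G} {𝓖} g X (extreme (h G g) t F≼G ¬G≼F X X∈)
  ...   | inj₂ r   = ⊥-elim (¬G≼F λ X X∈G → r X (step-increasing {G} X X∈G))

  linear : Tower F → Tower G → F ≼ G ⊎ G ≼ F
  linear {F} {G} t s with compare s (extreme s) t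
  ... | inj₁ q = inj₁ q
  ... | inj₂ q = inj₂ λ X X∈ → q X (step-increasing {G} X X∈)

  -- Intersections in a union rest on the chain property: two members lie together in the larger of
  -- their families.
  tower-filter : Tower F → IsFilter (_∈ F)
  tower-filter (next t) = stepBy-filter em (tower-filter t)
  tower-filter (limit 𝓖 h) = record
    { mono = λ X⊆Y X∈ → fromWitness (case toWitness X∈ of λ where
        (inj₁ b) → inj₁ (mono 𝓑-filter X⊆Y b)
        (inj₂ (F , g , X∈F)) → inj₂ (F , g , mono (tower-filter (h F g)) X⊆Y X∈F))
    ; intersect = λ X∈ Y∈ → fromWitness (meet (toWitness X∈) (toWitness Y∈))
    ; inhabited = λ X∈ → case toWitness X∈ of λ where
        (inj₁ b) → inhabited 𝓑-filter b
        (inj₂ (F , g , X∈F)) → inhabited (tower-filter (h F g)) X∈F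
    ; nonempty = let X , b = nonempty 𝓑-filter in X , fromWitness (inj₁ b)
    }
    where
    In : (I → Set ℓ) → Set (lsuc ℓ)
    In X = 𝓑 X ⊎ ∃ λ F → T (𝓖 F) × X ∈ F
    meetIn : ∀ F → T (𝓖 F) → X ∈ F → Y ∈ F → In (λ i → X i × Y i)
    meetIn F g X∈F Y∈F = inj₂ (F , g , intersect (tower-filter (h F g)) X∈F Y∈F)
    meet : In X → In Y → In (λ i → X i × Y i)
    meet (inj₁ b) (inj₁ c) = inj₁ (intersect 𝓑-filter b c)
    meet (inj₁ b) (inj₂ (F , g , Y∈F)) = meetIn F g (𝓑≼ (h F g) b) Y∈F
    meet (inj₂ (F , g , X∈F)) (inj₁ c) = meetIn F g X∈F (𝓑≼ (h F g) c)
    meet (inj₂ (F , g , X∈F)) (inj₂ (G , g′ , Y∈G)) with linear (h F g) (h G g′)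
    ... | inj₁ F≼G = meetIn G g′ (F≼G _ X∈F) Y∈G
    ... | inj₂ G≼F = meetIn F g X∈F (G≼F _ Y∈G)

  towers : Family → Bool
  towers F = isYes (em {P = Tower F})

  U : Family
  U = ⋃ towers

  U-tower : Tower U
  U-tower = limit towers λ F g → toWitness g

  𝒰 : (I → Set ℓ) → Set ℓ
  𝒰 X = Lift ℓ (X ∈ U)

  𝒰-filter : IsFilter 𝒰
  𝒰-filter = record
    { mono = λ X⊆Y (lift X∈) → lift (mono f X⊆Y X∈)
    ; intersect = λ (lift X∈) (lift Y∈) → lift (intersect f X∈ Y∈)
    ; inhabited = λ (lift X∈) → inhabited f X∈
    ; nonempty = let X , X∈ = nonempty f in X , lift X∈ }
    where f = tower-filter U-tower

  𝓑⊆𝒰 : 𝓑 X → 𝒰 X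
  𝓑⊆𝒰 b = lift (𝓑≼ U-tower b)

  -- `step U` is again in the tower, hence contained in the union `U`, which is thus a fixed point.
  𝒰-prime : ∀ X → 𝒰 X ⊎ 𝒰 (λ i → ¬ X i)
  𝒰-prime X with em {P = X ∈ U} | em {P = (λ i → ¬ X i) ∈ U}
  ... | yes X∈ | _      = inj₁ (lift X∈)
  ... | no _   | yes ∁∈ = inj₂ (lift ∁∈)
  ... | no X∉  | no ∁∉  = ⊥-elim (stepBy-decides em (tower-filter U-tower)
    (⋃-upper {step U} {towers} (fromWitness (next U-tower))) X (X∉ , ∁∉))

-- Ultrapowers and the theorem of Łoś.

module Ultrapower (em : ∀ {a} → ExcludedMiddle a) {I : Set ℓ} (𝒰 : (I → Set ℓ) → Set ℓ)
  (𝒰-filter : IsFilter 𝒰) (prime : ∀ X → 𝒰 X ⊎ 𝒰 (λ i → ¬ X i)) (M : Structure ℓ) where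

  open Classical em
  open IsFilter 𝒰-filter
  private
    module M = Structure M
    module ≈ = IsEquivalence M.isEquivalence
    variable X Y Z : I → Set ℓ

  full : (∀ i → X i) → 𝒰 X
  full h = mono (λ i _ → h i) (proj₂ nonempty)

  combine : (∀ i → X i → Y i → Z i) → 𝒰 X → 𝒰 Y → 𝒰 Z
  combine h u v = mono (λ i (x , y) → h i x y) (intersect u v)

  clash : (∀ i → X i → ¬ Y i) → 𝒰 X → ¬ 𝒰 Y
  clash h u v = let i , x , y = inhabited (intersect u v) in h i x y

  split : 𝒰 (λ i → X i ⊎ Y i) → 𝒰 X ⊎ 𝒰 Y
  split {X = X} u with prime X
  ... | inj₁ v = inj₁ v
  ... | inj₂ v = inj₂ (combine (λ i ¬x → [ (λ x → ⊥-elim (¬x x)) , id ]′) v u)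

  -- Excluded middle returns a witness at each coordinate that has one; at the others, a negligible
  -- set, the value is zero.
  choose : {R : I → M.Carrier → Set ℓ} →
    𝒰 (λ i → ∃ (R i)) → ∃ λ x → 𝒰 (λ i → R i (x i))
  choose {R} u = (λ i → value (em {P = ∃ (R i)})) , mono (λ i → correct em) u
    where
    value : {P : M.Carrier → Set ℓ} → Dec (∃ P) → M.Carrier
    value (yes (x , _)) = x
    value (no _)        = M.0#
    correct : {P : M.Carrier → Set ℓ} (d : Dec (∃ P)) → ∃ P → P (value d)
    correct (yes (_ , p)) _ = p
    correct (no ¬p)       p = ⊥-elim (¬p p)

  N : Structure ℓ
  N = record
    { Carrier = I → M.Carrier
    ; _≈_ = λ x y → 𝒰 λ i → x i M.≈ y i
    ; _<_ = λ x y → 𝒰 λ i → x i M.< y i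
    ; _+_ = λ x y i → x i M.+ y i
    ; _*_ = λ x y i → x i M.* y i
    ; 0# = λ _ → M.0#
    ; 1# = λ _ → M.1#
    ; isEquivalence = record
      { refl = full λ _ → ≈.refl
      ; sym = mono λ _ → ≈.sym
      ; trans = combine λ _ → ≈.trans }
    ; +-cong = combine λ _ → M.+-cong
    ; *-cong = combine λ _ → M.*-cong
    ; <-resp-≈ = combine (λ _ → proj₁ M.<-resp-≈) , combine (λ _ → proj₂ M.<-resp-≈)
    }
  private module N = Structure N

  N-PA⁻ : PA⁻ M → PA⁻ N
  N-PA⁻ pa = record
    { isCommutativeSemiring = isCommutativeSemiringˡ record
      { +-isCommutativeMonoid = isCommutativeMonoidˡ record
        { isSemigroup = record
          { isMagma = record { isEquivalence = N.isEquivalence ; ∙-cong = N.+-cong }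
          ; assoc = λ x y z → full λ i → S.+-assoc (x i) (y i) (z i) }
        ; identityˡ = λ x → full λ i → S.+-identityˡ (x i)
        ; comm = λ x y → full λ i → S.+-comm (x i) (y i) }
      ; *-isCommutativeMonoid = isCommutativeMonoidˡ record
        { isSemigroup = record
          { isMagma = record { isEquivalence = N.isEquivalence ; ∙-cong = N.*-cong }
          ; assoc = λ x y z → full λ i → S.*-assoc (x i) (y i) (z i) }
        ; identityˡ = λ x → full λ i → S.*-identityˡ (x i)
        ; comm = λ x y → full λ i → S.*-comm (x i) (y i) }
      ; distribʳ = λ x y z → full λ i → S.distribʳ (x i) (y i) (z i)
      ; zeroˡ = λ x → full λ i → S.zeroˡ (x i) }
    ; isStrictTotalOrder = record
      { isStrictPartialOrder = record
        { isEquivalence = N.isEquivalence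
        ; irrefl = clash λ _ → O.irrefl
        ; trans = combine λ _ → O.trans
        ; <-resp-≈ = N.<-resp-≈ }
      ; compare = compareᴺ }
    ; +-monoˡ-< = λ z → mono λ i → +-monoˡ-< (z i)
    ; *-monoˡ-< = λ z → combine λ i → *-monoˡ-< (z i)
    ; subtraction = λ x<y → choose (mono (λ i → subtraction) x<y)
    ; 0<1 = full λ _ → 0<1
    ; discrete = λ 0<x → split (mono (λ _ → discrete) 0<x)
    ; 0≤ = λ x → split (full λ i → 0≤ (x i))
    }
    where
    open PA⁻ pa
    module S = IsCommutativeSemiring isCommutativeSemiring
    module O = IsStrictTotalOrder isStrictTotalOrder
    compareᴺ : Trichotomous N._≈_ N._<_
    compareᴺ x y with split (full {X = λ i → (x i M.< y i) ⊎ ((x i M.≈ y i) ⊎ (y i M.< x i))}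
                               λ i → case O.compare (x i) (y i) of λ where
                                 (tri< a _ _) → inj₁ a
                                 (tri≈ _ b _) → inj₂ (inj₁ b)
                                 (tri> _ _ c) → inj₂ (inj₂ c))
    ... | inj₁ u = tri< u (λ v → clash (λ _ → O.irrefl) v u) (clash (λ _ → O.asym) u)
    ... | inj₂ u with split u
    ...   | inj₁ v = tri≈ (clash (λ _ → O.irrefl) v) v
                          (clash (λ _ → O.irrefl) (mono (λ _ → ≈.sym) v))
    ...   | inj₂ v = tri> (clash (λ _ → O.asym) v)
                          (λ w → clash (λ _ → O.irrefl) (mono (λ _ → ≈.sym) w) v) v

  infix 8 _at_
  _at_ : Vec N.Carrier n → I → Vec M.Carrier n
  xs at i = map (λ x → x i) xs

  ⟦⟧-at : (t : Term n) (xs : Vec N.Carrier n) (i : I) → ⟦_⟧ N t xs i ≡ ⟦_⟧ M t (xs at i)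
  ⟦⟧-at (var j)  xs i = sym (lookup-map j (λ x → x i) xs)
  ⟦⟧-at 0'       xs i = refl
  ⟦⟧-at 1'       xs i = refl
  ⟦⟧-at (s +' t) xs i = cong₂ M._+_ (⟦⟧-at s xs i) (⟦⟧-at t xs i)
  ⟦⟧-at (s *' t) xs i = cong₂ M._*_ (⟦⟧-at s xs i) (⟦⟧-at t xs i)

  𝒰-cong : (∀ i → X i ⇔ Y i) → 𝒰 X ⇔ 𝒰 Y
  𝒰-cong h = mk⇔ (mono λ i → to (h i)) (mono λ i → from (h i))

  𝒰-¬ : (¬ 𝒰 X) ⇔ 𝒰 (λ i → ¬ X i)
  𝒰-¬ {X = X} = mk⇔ (λ ¬u → [ (λ u → ⊥-elim (¬u u)) , id ]′ (prime X)) (clash λ _ ¬x x → ¬x x)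

  -- Negation, disjunction and implication rest on primality, the quantifiers on `choose`; for ∀ the
  -- chosen values are counterexamples.
  łoś : (φ : Formula n) (xs : Vec N.Carrier n) →
    (N ⊨ φ [ xs ]) ⇔ 𝒰 (λ i → M ⊨ φ [ xs at i ])
  łoś (s ≈' t) xs = 𝒰-cong λ i → ≡⇒⇔ (cong₂ M._≈_ (⟦⟧-at s xs i) (⟦⟧-at t xs i))
  łoś (s <' t) xs = 𝒰-cong λ i → ≡⇒⇔ (cong₂ M._<_ (⟦⟧-at s xs i) (⟦⟧-at t xs i))
  łoś (¬' φ)   xs = 𝒰-¬ ⇔-∘ ¬-cong-⇔ (łoś φ xs)
  łoś (φ ∧' ψ) xs = mk⇔ (λ (u , v) → intersect u v) (λ u → mono (λ _ → proj₁) u , mono (λ _ → proj₂) u)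
    ⇔-∘ (łoś φ xs ×-⇔ łoś ψ xs)
  łoś (φ ∨' ψ) xs = mk⇔ [ mono (λ _ → inj₁) , mono (λ _ → inj₂) ]′ split ⇔-∘ (łoś φ xs ⊎-⇔ łoś ψ xs)
  łoś (φ ⇒' ψ) xs = mk⇔
      (λ h → [ (λ u → mono (λ _ y _ → y) (h u)) , mono (λ _ ¬x x → ⊥-elim (¬x x)) ]′ (prime _))
      (combine λ _ h x → h x)
    ⇔-∘ →-cong-⇔ (łoś φ xs) (łoś ψ xs)
  łoś (∀' φ) xs = mk⇔
    (λ h → dne λ ¬u →
      let x , u = choose (mono (λ _ → ¬∀⇒∃¬) (to 𝒰-¬ ¬u))
      in clash (λ _ ¬g g → ¬g g) u (to (łoś φ (x ∷ xs)) (h x)))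
    (λ u x → from (łoś φ (x ∷ xs)) (mono (λ i g → g (x i)) u))
  łoś (∃' φ) xs = mk⇔
    (λ (x , g) → mono (λ i g → x i , g) (to (łoś φ (x ∷ xs)) g))
    (λ u → let x , v = choose u in x , from (łoś φ (x ∷ xs)) v)

  M⊆N : M ⊆ N
  M⊆N = record
    { ι = λ x _ → x
    ; isSemiringMonomorphism = record
      { isSemiringHomomorphism = record
        { isNearSemiringHomomorphism = record
          { +-isMonoidHomomorphism = record
            { isMagmaHomomorphism = record
              { isRelHomomorphism = record { cong = λ x≈y → full λ _ → x≈y }
              ; homo = λ _ _ → full λ _ → ≈.refl
              }
            ; ε-homo = full λ _ → ≈.refl
            }
          ; *-homo = λ _ _ → full λ _ → ≈.refl
          }
        ; 1#-homo = full λ _ → ≈.refl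
        }
      ; injective = λ u → proj₂ (inhabited u)
      }
    ; <-⇔ = λ _ _ → mk⇔ (λ x<y → full λ _ → x<y) (λ u → proj₂ (inhabited u))
    }

  M≺N : Elementary M⊆N
  M≺N φ _ xs = (⇔-sym (łoś φ _)
    ⇔-∘ 𝒰-cong λ i → ≡⇒⇔ (cong (λ zs → M ⊨ φ [ zs ]) (sym (diagonal xs i))))
    ⇔-∘ mk⇔ (λ g → full λ _ → g) (λ u → proj₂ (inhabited u))
    where
    diagonal : (xs : Vec M.Carrier n) (i : I) → map (λ x _ → x) xs at i ≡ xs
    diagonal []       i = refl
    diagonal (x ∷ xs) i = cong (x ∷_) (diagonal xs i)

-- From conditions on extensions to collection.

module FromExtensions (em : ∀ {a} → ExcludedMiddle a) (ext : ∀ {a b} → Extensionality a b)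
  (M : Structure ℓ) (paM : PA⁻ M) where

  open Classical em
  private module M = Structure M
  open IsStrictTotalOrder (PA⁻.isStrictTotalOrder paM) using (compare) renaming (trans to <-trans)

  Tail : (M.Carrier → Set ℓ) → Set ℓ
  Tail X = ∃ λ b → ∀ i → b M.< i → X i

  Tail-filter : IsFilter Tail
  Tail-filter = record
    { mono = λ X⊆Y (b , h) → b , λ i b<i → X⊆Y i (h i b<i)
    ; intersect = λ (b , h) (c , h′) → let m , g = max b c in
        m , λ i m<i → h i (proj₁ (g i m<i)) , h′ i (proj₂ (g i m<i))
    ; inhabited = λ (b , h) → M.1# M.+ b , h _ (Bounds.x<1+x M paM b)
    ; nonempty = (λ i → M.0# M.< i) , M.0# , λ _ 0<i → 0<i
    }
    where
    max : ∀ b c → ∃ λ m → ∀ i → m M.< i → b M.< i × c M.< i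
    max b c with compare b c
    ... | tri< b<c _ _ = c , λ i c<i → <-trans b<c c<i , c<i
    ... | tri≈ _ b≈c _ = b , λ i b<i → b<i , proj₂ M.<-resp-≈ b≈c b<i
    ... | tri> _ _ c<b = b , λ i b<i → b<i , <-trans c<b b<i

  open Ultrafilter em ext Tail Tail-filter using (𝒰; 𝒰-filter; 𝒰-prime; 𝓑⊆𝒰)
  open Ultrapower em 𝒰 𝒰-filter 𝒰-prime M
  open Supremum (N-PA⁻ paM) M⊆N using (S)

  -- Each entry is at most a constant b, and b lies below i on a final segment, a set in `𝒰`.
  bounded-by-id : (ys : Vec ∣ S ∣ q) → 𝒰 λ i → _<ᵛ_ M (map proj₁ ys at i) (replicate q i)
  bounded-by-id [] = full λ _ → []
  bounded-by-id ((y , b , y≤b) ∷ ys) = combine (λ _ → _∷_) (y<i y≤b) (bounded-by-id ys)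
    where
    y<i : Structure._≤_ N y (λ _ → b) → 𝒰 λ i → y i M.< i
    y<i (inj₁ y<b) = combine (λ _ → <-trans) y<b (𝓑⊆𝒰 (b , λ _ b<i → b<i))
    y<i (inj₂ y≈b) = combine (λ _ y≈b b<i → proj₂ M.<-resp-≈ (IsEquivalence.sym M.isEquivalence y≈b) b<i)
                       y≈b (𝓑⊆𝒰 (b , λ _ b<i → b<i))

  -- The Πₖ matrix is absolute because its dual is Σₖ; witnesses are mapped along the embedding.
  elementary-Σ-up : {A B : Structure ℓ} (e : A ⊆ B) → Elementary[ IsΣ k ] e →
    {φ : Formula m} → IsΣ (suc k) φ → ∀ xs → (A ⊨ φ [ xs ]) → B ⊨ φ [ map (_⊆_.ι e) xs ]
  elementary-Σ-up e el (ex d) xs (y , g) = _⊆_.ι e y , elementary-Σ-up e el d (y ∷ xs) g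
  elementary-Σ-up {A = A} {B} e el (matrix d) xs g = dne λ ¬g →
    to (⊨∼Π A d xs) (from (el (∼Π d) (∼Π-Σ d) xs) (from (⊨∼Π B d _) ¬g)) g

  -- If collection fails at us, let the i-th coordinate of xs ∈ Nᵖ be a counterexample to
  -- the bounds (i , … , i).  Then xs ∈ S, and its witness in S is bounded by the
  -- class of the identity.
  cof⇒coll : end M k → cof≡ M (suc (suc k)) → Coll-w-minus M (IsΣ (suc k))
  cof⇒coll {k = k} end-k cof {p} {q} φ d total us = dne contradiction
    where
    -- Totality of φ becomes one Πₖ₊₂ sentence, whose dual is a Σₖ₊₂ sentence to which the
    -- cofinality condition applies.
    Φ : Formula 0
    Φ = ∀^ p (∃^ q (ren (Fin.lift q (_↑ˡ 0)) φ))
    Φ-Π : IsΠ (suc (suc k)) Φ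
    Φ-Π = ∀^-Π p (matrix (∃^-Σ q (ren-Σ _ d)))
    ⊨Φ : (A : Structure ℓ) → (A ⊨ Φ [ [] ]) ⇔
      (∀ (xs : Vec ∣ A ∣ p) → ∃ λ (ys : Vec ∣ A ∣ q) → A ⊨ φ [ ys ++ xs ])
    ⊨Φ A = (∀-⇔ λ xs → (∃-⇔ λ ys → ⊨ren A _ (lift-renames ys (lookup-++ˡ xs [])) φ)
                        ⇔-∘ ⊨∃^ A q _ (xs ++ []))
           ⇔-∘ ⊨∀^ A p _ []
    total-S : ∀ (xs : Vec ∣ S ∣ p) → ∃ λ (ys : Vec ∣ S ∣ q) → S ⊨ φ [ ys ++ xs ]
    total-S = to (⊨Φ S) (dne λ ¬Φ → to (⊨∼Π M Φ-Π [])
      (from (cof N (N-PA⁻ paM) M⊆N M≺N (∼Π Φ-Π) (∼Π-Σ Φ-Π)) (from (⊨∼Π S Φ-Π []) ¬Φ))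
      (from (⊨Φ M) total))

    Bounded : Vec M.Carrier q → Vec M.Carrier p → Set ℓ
    Bounded vs xs = ∃ λ ys → _<ᵛ_ M ys vs × (M ⊨ φ [ ys ++ xs ])

    contradiction : ¬ ¬ ∃ λ vs → ∀ xs → _<ᵛ_ M xs us → Bounded vs xs
    contradiction none =
      clash (λ i g ys<i → proj₂ (proj₂ (bad i)) (_ , ys<i , subst (λ zs → M ⊨ φ [ zs ]) (at-i i) g))
        (to (łoś φ _) (elementary-Σ-up (sup⊆ (N-PA⁻ paM) M⊆N) (end-k N (N-PA⁻ paM) M⊆N M≺N) d _ g))
        (bounded-by-id ys)
      where
      bad : ∀ i → ∃ λ xs → _<ᵛ_ M xs us × (¬ Bounded (replicate q i) xs)
      bad i = let xs , f = ¬∀⇒∃¬ (λ h → none (replicate q i , h)) in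
        xs , dne (λ ¬p → f λ p → ⊥-elim (¬p p)) , λ b → f λ _ → b
      -- At every index entry j lies below the constant `lookup us j`, which puts it into the
      -- supremum.
      xs : Vec ∣ S ∣ p
      xs = tabulate λ j → (λ i → lookup (proj₁ (bad i)) j) , lookup us j ,
        inj₁ (full λ i → Pointwise.lookup (proj₁ (proj₂ (bad i))) j)
      ys = proj₁ (total-S xs)
      g = proj₂ (total-S xs)
      xs-at : ∀ i → map proj₁ xs at i ≡ proj₁ (bad i)
      xs-at i = trans (sym (map-∘ _ proj₁ xs)) (trans (sym (tabulate-∘ _ _)) (tabulate∘lookup _))
      at-i : ∀ i → map proj₁ (ys ++ xs) at i ≡ (map proj₁ ys at i) ++ proj₁ (bad i)
      at-i i = trans (cong (_at i) (map-++ proj₁ ys xs))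
        (trans (map-++ (λ x → x i) (map proj₁ ys) (map proj₁ xs)) (cong ((map proj₁ ys at i) ++_) (xs-at i)))

theorem5p4 :
    (∀ {a : Level} → ExcludedMiddle a) →
    (∀ {a b : Level} → Extensionality a b) →
    ∀ {ℓ : Level} (M : Structure ℓ) → PA⁻ M → (n : ℕ) →
    (Coll-w-d M (IsΣ (suc n)) ⇔ Coll-w-minus M (IsΣ (suc n))) ×
    (Coll-w-minus M (IsΣ (suc n)) ⇔ (end M n × COF≡ M (suc (suc n)))) ×
    ((end M n × COF≡ M (suc (suc n))) ⇔ (end M n × cof≡ M (suc (suc n))))
theorem5p4 em ext M pa n =
    mk⇔ d⇒minus minus⇒d
  , mk⇔ coll⇒3 (λ (end-n , COF) → cof⇒coll end-n (COF⇒cof M pa COF))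
  , mk⇔ (λ (end-n , COF) → end-n , COF⇒cof M pa COF)
        (λ (end-n , cof) → coll⇒3 (cof⇒coll end-n cof))
  where
  open Bounds M pa
  open WeakCollection em
  open FromExtensions em ext M pa
  coll⇒3 : Coll-w-minus M (IsΣ (suc n)) → end M n × COF≡ M (suc (suc n))
  coll⇒3 coll = coll⇒end M pa coll , coll⇒COF M coll
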